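{- Let $n\ge 1$ and $r\ge 1$ be integers, let $\chi$ be a multiplicative character of $\mathbb{Z}_n^*$, and let $\lambda$ be the additive character $\lambda(x)=\exp\left(\frac{2\pi\sqrt{ -1}\,ax}{n}\right)$ of $\mathbb{Z}_n$, where $a\in\mathbb{Z}$ satisfies $\gcd(a,n)=1$ (i.e. $\lambda$ has order $n$). Then $$G(\mathrm{GL}_r(\mathbb{Z}_n),\chi,\lambda)=G(\mathbb{Z}_n,\chi,\lambda)^r\, n^{\frac{r(r-1)}{2}}.$$
   Context: $\mathbb{Z}_n=\mathbb{Z}/n\mathbb{Z}$, $\mathbb{Z}_n^*$ is its unit group, and $\mathrm{GL}_r(\mathbb{Z}_n)$ is the group of invertible $r\times r$ matrices over $\mathbb{Z}_n$. The classical Gauss sum is $G(\mathbb{Z}_n,\chi,\lambda)=\sum_{x\in\mathbb{Z}_n^*}\chi(x)\lambda(x)$, and the Gauss sum for the general linear group is $G(\mathrm{GL}_r(\mathbb{Z}_n),\chi,\lambda)=\sum_{X\in\mathrm{GL}_r(\mathbb{Z}_n)}\chi(\det X)\lambda(\mathrm{tr}\,X)$. -}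

module Defs where

open import Level using (Level)
open import Data.Nat as ℕ using (ℕ; zero; suc; NonZero; _<_)
open import Data.Nat.DivMod using (_mod_)
open import Data.Nat.GCD using (gcd)
open import Data.Integer as ℤ using (ℤ; +_)
open import Data.Integer.DivMod using (_%ℕ_)
open import Data.Fin using (Fin; toℕ; punchIn) renaming (zero to fzero; suc to fsuc)
open import Data.List using (List; []; _∷_; map; concatMap; filter; foldr)
open import Data.Bool.ListAction using (any)
open import Data.List.Base using ([_])
open import Data.Fin.Base using () 
open import Data.List.Base using () renaming (allFin to allFinL)
open import Data.Vec.Functional using (Vector) renaming (_∷_ to _∷ᵥ_)
open import Data.Bool using (Bool; T; _∧_)
open import Data.Fin.Properties using (_≟_)
open import Relation.Nullary.Decidable using (does)
open import Relation.Binary.PropositionalEquality using (_≡_)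
open import Data.Product using (_×_)
open import Data.Sum using (_⊎_)
open import Relation.Nullary using (¬_)
open import Algebra.Bundles using (CommutativeRing)

allFuns : ∀ {a} {A : Set a} (m : ℕ) → List A → List (Fin m → A)
allFuns zero    xs = [ (λ ()) ]
allFuns (suc m) xs = concatMap (λ x → map (λ f → x ∷ᵥ f) (allFuns m xs)) xs

module Zmod (n : ℕ) .{{_ : NonZero n}} where

  Zn : Set
  Zn = Fin n

  [_]ₙ : ℕ → Zn
  [ k ]ₙ = k mod n

  [_]ᵢ : ℤ → Zn
  [ z ]ᵢ = [ z %ℕ n ]ₙ

  elems : List Zn
  elems = allFinL n

  oneₙ : Zn
  oneₙ = [ 1 ]ₙ

  _·ₙ_ : Zn → Zn → Zn
  x ·ₙ y = [ toℕ x ℕ.* toℕ y ]ₙ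

  isUnit : Zn → Bool
  isUnit x = any (λ y → does ((x ·ₙ y) ≟ oneₙ)) elems

  units : List Zn
  units = filter (λ x → T? (isUnit x)) elems
    where
    open import Relation.Nullary.Decidable using () renaming (T? to T?′)
    T? = T?′

  Mat : ℕ → Set
  Mat r = Fin r → Fin r → Zn

  sumℕ : ∀ {r} → (Fin r → ℕ) → ℕ
  sumℕ {zero}  f = 0
  sumℕ {suc r} f = f fzero ℕ.+ sumℕ (λ i → f (fsuc i))

  _⊗_ : ∀ {r} → Mat r → Mat r → Mat r
  (X ⊗ Y) i j = [ sumℕ (λ k → toℕ (X i k) ℕ.* toℕ (Y k j)) ]ₙ

  idMat : ∀ {r} → Mat r
  idMat i j = [ (if does (i ≟ j) then 1 else 0) ]ₙ
    where open import Data.Bool using (if_then_else_)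

  eqMatᵇ : ∀ {r} → Mat r → Mat r → Bool
  eqMatᵇ {r} X Y =
    foldr _∧_ Bool.true
      (concatMap (λ i → map (λ j → does (X i j ≟ Y i j)) (allFinL r)) (allFinL r))
    where import Data.Bool as Bool

  allMats : (r : ℕ) → List (Mat r)
  allMats r = allFuns r (allFuns r elems)

  isInvertible : ∀ {r} → Mat r → Bool
  isInvertible {r} X = any (λ Y → eqMatᵇ (X ⊗ Y) idMat) (allMats r)

  GL : (r : ℕ) → List (Mat r)
  GL r = filter (λ X → T? (isInvertible X)) (allMats r)
    where
    open import Relation.Nullary.Decidable using () renaming (T? to T?′)
    T? = T?′

  detℤ : ∀ {r} → (Fin r → Fin r → ℤ) → ℤ
  detℤ {zero}  A = + 1
  detℤ {suc r} A = go (suc r) (λ j → j)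
    where
    sign : ℕ → ℤ
    sign zero          = + 1
    sign (suc zero)    = ℤ.- (+ 1)
    sign (suc (suc k)) = sign k
    minor : Fin (suc r) → Fin r → Fin r → ℤ
    minor j i k = A (fsuc i) (punchIn j k)
    go : (m : ℕ) → (Fin m → Fin (suc r)) → ℤ
    go zero    js = + 0
    go (suc m) js = sign (toℕ (js fzero)) ℤ.* A fzero (js fzero) ℤ.* detℤ (minor (js fzero))
                    ℤ.+ go m (λ i → js (fsuc i))

  det : ∀ {r} → Mat r → Zn
  det X = [ detℤ (λ i j → + toℕ (X i j)) ]ᵢ

  tr : ∀ {r} → Mat r → Zn
  tr X = [ sumℕ (λ i → toℕ (X i i)) ]ₙ

module InRing {c ℓ} (R : CommutativeRing c ℓ) where
  open CommutativeRing R

  infixr 8 _^ᴿ_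
  _^ᴿ_ : Carrier → ℕ → Carrier
  x ^ᴿ zero  = 1#
  x ^ᴿ suc k = x * (x ^ᴿ k)

  ΣR : ∀ {a} {A : Set a} → List A → (A → Carrier) → Carrier
  ΣR xs f = foldr (λ x s → f x + s) 0# xs

  ℕ→R : ℕ → Carrier
  ℕ→R zero    = 0#
  ℕ→R (suc k) = 1# + ℕ→R k

  IsIntegralDomain : Set (c Level.⊔ ℓ)
  IsIntegralDomain = (¬ (1# ≈ 0#)) × (∀ x y → x * y ≈ 0# → (x ≈ 0#) ⊎ (y ≈ 0#))

  IsPrimitiveRoot : ℕ → Carrier → Set ℓ
  IsPrimitiveRoot n ζ = (ζ ^ᴿ n ≈ 1#) × (∀ k → 0 < k → k < n → ¬ (ζ ^ᴿ k ≈ 1#))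

  module _ (n : ℕ) .{{_ : NonZero n}} where
    open Zmod n

    -- χ : ℤ_n → R is a multiplicative character of ℤ_n^* (only its values on
    -- units matter)
    IsMultChar : (Zn → Carrier) → Set ℓ
    IsMultChar χ = (χ oneₙ ≈ 1#) ×
      (∀ x y → T (isUnit x) → T (isUnit y) → χ (x ·ₙ y) ≈ χ x * χ y)

    addChar : Carrier → ℤ → Zn → Carrier
    addChar ζ a x = ζ ^ᴿ ((a ℤ.* + toℕ x) %ℕ n)

    gaussZ : (Zn → Carrier) → (Zn → Carrier) → Carrier
    gaussZ χ λ′ = ΣR units (λ x → χ x * λ′ x)

    gaussGL : ℕ → (Zn → Carrier) → (Zn → Carrier) → Carrier
    gaussGL r χ λ′ = ΣR (GL r) (λ X → χ (det X) * λ′ (tr X))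

{-# OPTIONS --safe #-}
-- Extend χ by 0 to a multiplicative function h on ℤ/n, so that the Gauss sum of
-- GL_r becomes the sum of h(det X) λ(tr X) over all matrices X (X is invertible
-- iff det X is a unit).  Split it by the first row u of X.  Adding u to row j
-- permutes the remaining rows, keeps det X and adds u_j to tr X, so the partial
-- sum S_u satisfies S_u = λ(u_j) S_u; it vanishes if u_j ≠ 0 for some j > 1,
-- because λ is faithful and R is a domain.  For u = (x, 0, …, 0) one has
-- det X = x det X′ and tr X = x + tr X′, where X′ is the lower right block, while
-- the rest of the first column is free.  Hence G_{r+1} = n^r G_1 G_r.
module Submission where

open import Defs
open import Level using (0ℓ; _⊔_)
open import Data.Nat as ℕ using (ℕ; zero; suc; NonZero; _∸_; _≤_; _/_) renaming (_*_ to _*ℕ_)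
import Data.Nat.Properties as ℕ
import Data.Nat.DivMod as ℕ
import Data.Nat.Divisibility as ℕ
open import Data.Nat.GCD using (gcd)
open import Data.Nat.Coprimality as Coprimality using (coprime-divisor; gcd≡1⇒coprime)
open import Data.Integer as ℤ using (ℤ; +_; -[1+_]; _%ℕ_; _/ℕ_; ∣_∣)
import Data.Integer.Properties as ℤ
import Data.Integer.DivMod as ℤ
open import Data.Bool.Base using (Bool; true; false; T; _∧_; if_then_else_)
open import Data.Bool.Properties using (T-∧)
open import Data.Fin.Base using (Fin; zero; suc; toℕ; punchIn; punchOut)
open import Data.Fin.Properties using (_≟_; suc-injective; toℕ<n; toℕ-fromℕ<; toℕ-injective; punchIn-punchOut)
import Data.Fin.Permutation as Permutation
open import Data.List.Base using (List; []; _∷_; _++_; map; concatMap; filter; foldr; allFin; tabulate; length)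
open import Data.List.Properties using (length-tabulate)
open import Data.List.Membership.Propositional using (lose)
open import Data.List.Membership.Propositional.Properties using (∈-allFin)
import Data.List.Relation.Unary.All as All
import Data.List.Relation.Unary.All.Properties as All
open import Data.List.Relation.Unary.Any as Any using (Any; here)
import Data.List.Relation.Unary.Any.Properties as Any
open import Data.Maybe.Base using (Maybe; just; nothing)
open import Data.Product.Base using (∃; _×_; _,_; proj₁; proj₂)
open import Data.Sum.Base using (inj₁; inj₂)
open import Data.Unit.Polymorphic.Base using (⊤; tt)
open import Data.Vec.Functional using (Vector; head; tail; insertAt; updateAt) renaming (_∷_ to _∷ᵥ_)
open import Data.Vec.Functional.Properties using (insertAt-lookup; insertAt-punchIn; updateAt-updates; updateAt-minimal)
open import Function.Base using (_∘_; const; id)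
open import Function.Bundles using (Equivalence)
open import Relation.Nullary.Decidable using (Dec; does; yes; no; T?; dec-true; dec-false)
open import Relation.Nullary.Negation using (contradiction)
open import Relation.Binary.PropositionalEquality as ≡ using (_≡_; _≢_)
import Relation.Binary.Reasoning.Setoid as SetoidReasoning
open import Algebra.Bundles using (CommutativeRing)
import Algebra.Properties.AbelianGroup
import Algebra.Properties.CommutativeSemigroup
import Algebra.Properties.Group
import Algebra.Properties.Ring
import Algebra.Properties.Semiring.Mult.TCOptimised
import Algebra.Properties.Semiring.Sum
import Algebra.Solver.Ring
open import Algebra.Solver.Ring.AlmostCommutativeRing using (_-Raw-AlmostCommutative⟶_; fromCommutativeRing)

-- The facts about determinants are therefore derived over any commutative ring, from the uniqueness
-- of alternating multilinear functions of the rows. Invertibility, which is defined as a search for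
-- a right inverse, then matches a unit determinant: multiplicativity gives one direction, the
-- adjugate the other. The determinant of the statement is computed over ℤ on representatives and
-- reduced afterwards, so it has to be identified with a determinant formed inside ℤ/n. Extending χ
-- by 0 lets the rows and entries of X range independently, so that the sum over matrices is an
-- iterated sum over rows and then over entries. Matrices are functions and are compared only
-- pointwise; this is why summands carry congruence hypotheses throughout. The exponent of n is the
-- sum 0 + 1 + ... + (r - 1) collected by unrolling the recursion.

-- The homomorphism from ℤ to a commutative ring, and a ring solver with integer coefficients.

module IntegerMultiples {c ℓ} (K : CommutativeRing c ℓ) where
  open CommutativeRing K
  open Algebra.Properties.Ring ring
  open Algebra.Properties.AbelianGroup +-abelianGroup using (⁻¹-∙-comm)
  open Algebra.Properties.CommutativeSemigroup +-commutativeSemigroup using (interchange)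
  open Algebra.Properties.Semiring.Mult.TCOptimised semiring renaming (_×_ to _×ᴿ_)
  open SetoidReasoning setoid

  ι : ℤ → Carrier
  ι (+ n)    = n ×ᴿ 1#
  ι -[1+ n ] = - (suc n ×ᴿ 1#)

  ι-neg : ∀ z → ι (ℤ.- z) ≈ - ι z
  ι-neg (+ zero)  = sym -0#≈0#
  ι-neg (+ suc n) = refl
  ι-neg -[1+ n ]  = sym (-‿involutive _)

  ι-⊖ : ∀ m n → ι (m ℤ.⊖ n) ≈ m ×ᴿ 1# + - (n ×ᴿ 1#)
  ι-⊖ zero    n       = begin
    ι (0 ℤ.⊖ n)       ≡⟨ ≡.cong ι (ℤ.⊖-≤ {0} {n} ℕ.z≤n) ⟩
    ι (ℤ.- (+ n))     ≈⟨ ι-neg (+ n) ⟩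
    - (n ×ᴿ 1#)        ≈⟨ +-identityˡ _ ⟨
    0# + - (n ×ᴿ 1#)   ∎
  ι-⊖ (suc m) zero    = begin
    suc m ×ᴿ 1#            ≈⟨ +-identityʳ _ ⟨
    suc m ×ᴿ 1# + 0#       ≈⟨ +-congˡ -0#≈0# ⟨
    suc m ×ᴿ 1# + - 0#     ∎
  ι-⊖ (suc m) (suc n) = begin
    ι (suc m ℤ.⊖ suc n)                       ≡⟨ ≡.cong ι (ℤ.[1+m]⊖[1+n]≡m⊖n m n) ⟩
    ι (m ℤ.⊖ n)                               ≈⟨ ι-⊖ m n ⟩
    -- Inserting 1 + (-1) supplies the extra unit on each side.
    m ×ᴿ 1# + - (n ×ᴿ 1#)                       ≈⟨ +-identityˡ _ ⟨
    0# + (m ×ᴿ 1# + - (n ×ᴿ 1#))                ≈⟨ +-congʳ (-‿inverseʳ 1#) ⟨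
    (1# + - 1#) + (m ×ᴿ 1# + - (n ×ᴿ 1#))       ≈⟨ interchange _ _ _ _ ⟩
    (1# + m ×ᴿ 1#) + (- 1# + - (n ×ᴿ 1#))       ≈⟨ +-cong (1+× m 1#) (trans (-‿cong (1+× n 1#)) (sym (⁻¹-∙-comm _ _))) ⟨
    suc m ×ᴿ 1# + - (suc n ×ᴿ 1#)               ∎

  ι-+ : ∀ y z → ι (y ℤ.+ z) ≈ ι y + ι z
  ι-+ (+ m)    (+ n)    = ×-homo-+ 1# m n
  ι-+ (+ m)    -[1+ n ] = ι-⊖ m (suc n)
  ι-+ -[1+ m ] (+ n)    = trans (ι-⊖ n (suc m)) (+-comm _ _)
  ι-+ -[1+ m ] -[1+ n ] = begin
    - (suc (suc (m ℕ.+ n)) ×ᴿ 1#)      ≡⟨ ≡.cong (λ k → - (suc k ×ᴿ 1#)) (ℕ.+-suc m n) ⟨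
    - ((suc m ℕ.+ suc n) ×ᴿ 1#)        ≈⟨ -‿cong (×-homo-+ 1# (suc m) (suc n)) ⟩
    - (suc m ×ᴿ 1# + suc n ×ᴿ 1#)       ≈⟨ ⁻¹-∙-comm _ _ ⟨
    - (suc m ×ᴿ 1#) + - (suc n ×ᴿ 1#)   ∎

  ι-*-pos : ∀ m z → ι (+ m ℤ.* z) ≈ ι (+ m) * ι z
  ι-*-pos m (+ n) = begin
    ι (+ m ℤ.* + n)         ≡⟨ ≡.cong ι (ℤ.pos-* m n) ⟨
    (m ℕ.* n) ×ᴿ 1#          ≈⟨ ×1-homo-* m n ⟩
    (m ×ᴿ 1#) * (n ×ᴿ 1#)     ∎
  ι-*-pos m -[1+ n ] = begin
    ι (+ m ℤ.* -[1+ n ])        ≡⟨ ≡.cong ι (ℤ.neg-distribʳ-* (+ m) (+ suc n)) ⟨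
    ι (ℤ.- (+ m ℤ.* + suc n))   ≈⟨ ι-neg (+ m ℤ.* + suc n) ⟩
    - ι (+ m ℤ.* + suc n)       ≈⟨ -‿cong (ι-*-pos m (+ suc n)) ⟩
    - (ι (+ m) * ι (+ suc n))   ≈⟨ -‿distribʳ-* _ _ ⟩
    ι (+ m) * - ι (+ suc n)     ∎

  ι-* : ∀ y z → ι (y ℤ.* z) ≈ ι y * ι z
  ι-* (+ m)    z = ι-*-pos m z
  ι-* -[1+ m ] z = begin
    ι (-[1+ m ] ℤ.* z)          ≡⟨ ≡.cong ι (ℤ.neg-distribˡ-* (+ suc m) z) ⟨
    ι (ℤ.- (+ suc m ℤ.* z))     ≈⟨ ι-neg (+ suc m ℤ.* z) ⟩
    - ι (+ suc m ℤ.* z)         ≈⟨ -‿cong (ι-*-pos (suc m) z) ⟩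
    - (ι (+ suc m) * ι z)       ≈⟨ -‿distribˡ-* _ _ ⟩
    - ι (+ suc m) * ι z         ∎

  private
    ι-morphism : ℤ.+-*-rawRing -Raw-AlmostCommutative⟶ fromCommutativeRing K
    ι-morphism = record
      { ⟦_⟧ = ι ; +-homo = ι-+ ; *-homo = ι-* ; -‿homo = ι-neg ; 0-homo = refl ; 1-homo = refl }

    -- The solver needs only a sound test: `ι` need not be injective, so distinct integers yield
    -- `nothing` rather than a refutation.
    ι-≟ : ∀ y z → Maybe (ι y ≈ ι z)
    ι-≟ y z with y ℤ.≟ z
    ... | yes ≡.refl = just refl
    ... | no _       = nothing

  module Solver = Algebra.Solver.Ring ℤ.+-*-rawRing (fromCommutativeRing K) ι-morphism ι-≟

-- Alternating multilinear functions of the rows over a commutative ring.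

module Determinant {c ℓ} (K : CommutativeRing c ℓ) where
  open CommutativeRing K hiding (zero)
  open Algebra.Properties.Ring ring
  open Algebra.Properties.AbelianGroup +-abelianGroup using (inverseˡ-unique)
  open Algebra.Properties.Semiring.Sum semiring public
  open IntegerMultiples.Solver K using (solve; _:=_; _:+_; _:*_; :-_; con)
  open SetoidReasoning setoid

  Matrix : ℕ → ℕ → Set c
  Matrix r m = Vector (Vector Carrier m) r

  infix 4 _≋_
  _≋_ : ∀ {m} → Vector Carrier m → Vector Carrier m → Set ℓ
  u ≋ v = ∀ j → u j ≈ v j

  ≋-refl : ∀ {m} {u : Vector Carrier m} → u ≋ u
  ≋-refl _ = refl

  ≋-sym : ∀ {m} {u v : Vector Carrier m} → u ≋ v → v ≋ u
  ≋-sym p j = sym (p j)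

  sum-zero : ∀ {m} (u : Vector Carrier m) → (∀ j → u j ≈ 0#) → sum u ≈ 0#
  sum-zero {m} u u≈0 = trans (sum-cong-≋ u≈0) (sum-replicate-zero m)

  sum-head : ∀ {m} (u : Vector Carrier (suc m)) → (∀ j → u (suc j) ≈ 0#) → sum u ≈ u zero
  sum-head u u≈0 = trans (+-congˡ (sum-zero (tail u) u≈0)) (+-identityʳ _)

  sum-linear : ∀ {m} d {u v w : Vector Carrier m} →
               (∀ j → u j ≈ v j + d * w j) → sum u ≈ sum v + d * sum w
  sum-linear d {u} {v} {w} eq = begin
    sum u                           ≈⟨ sum-cong-≋ eq ⟩
    sum (λ j → v j + d * w j)       ≈⟨ ∑-distrib-+ v (λ j → d * w j) ⟩
    sum v + sum (λ j → d * w j)     ≈⟨ +-congˡ (*-distribˡ-sum d w) ⟨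
    sum v + d * sum w               ∎

  -- Branching on `does` makes `δ (suc i) (suc j)` compute to `δ i j`, on which the recursions over
  -- `δ` rely.
  δ : ∀ {m} → Matrix m m
  δ i j = if does (i ≟ j) then 1# else 0#

  δ-diag : ∀ {m} (i : Fin m) → δ i i ≡ 1#
  δ-diag i = ≡.cong (λ b → if b then 1# else 0#) (dec-true (i ≟ i) ≡.refl)

  δ-off : ∀ {m} {i j : Fin m} → i ≢ j → δ i j ≡ 0#
  δ-off {i = i} {j} i≢j = ≡.cong (λ b → if b then 1# else 0#) (dec-false (i ≟ j) i≢j)

  sum-δ : ∀ {m} (u : Vector Carrier m) l → sum (λ j → u j * δ j l) ≈ u l
  sum-δ u zero    = trans (sum-head (λ j → u j * δ j zero) (λ j → zeroʳ _)) (*-identityʳ _)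
  sum-δ u (suc l) = trans (+-cong (zeroʳ _) (sum-δ (tail u) l)) (+-identityˡ _)

  sum-add-δ : ∀ {m} (u v : Vector Carrier m) l → sum (λ j → u j + δ j l * v j) ≈ sum u + v l
  sum-add-δ u v l = begin
    sum (λ j → u j + δ j l * v j)       ≈⟨ ∑-distrib-+ u (λ j → δ j l * v j) ⟩
    sum u + sum (λ j → δ j l * v j)     ≈⟨ +-congˡ (sum-cong-≋ (λ j → *-comm (δ j l) (v j))) ⟩
    sum u + sum (λ j → v j * δ j l)     ≈⟨ +-congˡ (sum-δ v l) ⟩
    sum u + v l                         ∎

  -- Linearity is a relation between three given matrices, so no updated row has to be formed, and
  -- additivity and homogeneity share one equation. Only equal neighbouring rows are required to
  -- give zero, which is what a Laplace expansion yields by direct recursion; `alternating` extends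
  -- this to any two rows.
  record MultiAlternating {r m} (f : Matrix r m → Carrier) : Set (c ⊔ ℓ) where
    field
      cong : ∀ {X Y} → (∀ i → X i ≋ Y i) → f X ≈ f Y
      linear : ∀ i d {X Y Z} → (∀ j → X i j ≈ Y i j + d * Z i j) →
               (∀ k → k ≢ i → X k ≋ Y k) → (∀ k → k ≢ i → X k ≋ Z k) →
               f X ≈ f Y + d * f Z
      adjacent : ∀ i k → toℕ k ≡ suc (toℕ i) → ∀ {X} → X i ≋ X k → f X ≈ 0#

  open MultiAlternating

  fix-head : ∀ {r m} {f : Matrix (suc r) m → Carrier} → MultiAlternating f →
             ∀ v → MultiAlternating (λ X → f (v ∷ᵥ X))
  fix-head F v = record
    { cong     = λ p → cong F λ { zero → ≋-refl ; (suc i) → p i }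
    ; linear   = λ i d p q s → linear F (suc i) d p
                   (λ { zero _ → ≋-refl ; (suc k) k≢i → q k (k≢i ∘ ≡.cong suc) })
                   (λ { zero _ → ≋-refl ; (suc k) k≢i → s k (k≢i ∘ ≡.cong suc) })
    ; adjacent = λ i k k≡1+i p → adjacent F (suc i) (suc k) (≡.cong suc k≡1+i) p
    }

  -- Produces the functions to which uniqueness is applied: multiplication of every row by a fixed
  -- matrix, and insertion of a zero column.
  map-rows : ∀ {r m m′} {f : Matrix r m → Carrier} → MultiAlternating f →
             (t : Vector Carrier m′ → Vector Carrier m) →
             (∀ d {u v w} → (∀ j → u j ≈ v j + d * w j) → ∀ j → t u j ≈ t v j + d * t w j) →
             (∀ {u v} → u ≋ v → t u ≋ t v) →
             MultiAlternating (λ X → f (λ i → t (X i)))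
  map-rows F t t-linear t-cong = record
    { cong     = λ p → cong F (λ i → t-cong (p i))
    ; linear   = λ i d p q s → linear F i d (t-linear d p)
                   (λ k k≢i → t-cong (q k k≢i)) (λ k k≢i → t-cong (s k k≢i))
    ; adjacent = λ i k k≡1+i p → adjacent F i k k≡1+i (t-cong p)
    }

  ∷-η : ∀ {r m} (X : Matrix (suc r) m) → ∀ i → X i ≋ (head X ∷ᵥ tail X) i
  ∷-η X zero    = ≋-refl
  ∷-η X (suc i) = ≋-refl

  module _ {r m} {f : Matrix (suc (suc r)) m → Carrier} (F : MultiAlternating f) where
    -- Polarization: with both rows equal to u + v the value is 0, and expanding it leaves only the
    -- two mixed terms.
    swap : ∀ u v X → f (u ∷ᵥ v ∷ᵥ X) ≈ - f (v ∷ᵥ u ∷ᵥ X)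
    swap u v X = inverseˡ-unique _ _ (begin
      f (u ∷ᵥ v ∷ᵥ X) + f (v ∷ᵥ u ∷ᵥ X)
        ≈⟨ expand (f (u ∷ᵥ v ∷ᵥ X)) (f (v ∷ᵥ u ∷ᵥ X)) ⟩
      (0# + 1# * f (u ∷ᵥ v ∷ᵥ X)) + 1# * (f (v ∷ᵥ u ∷ᵥ X) + 1# * 0#)
        ≈⟨ +-cong (+-congʳ (same u)) (*-congˡ (+-congˡ (*-congˡ (same v)))) ⟨
      (f (u ∷ᵥ u ∷ᵥ X) + 1# * f (u ∷ᵥ v ∷ᵥ X)) + 1# * (f (v ∷ᵥ u ∷ᵥ X) + 1# * f (v ∷ᵥ v ∷ᵥ X))
        ≈⟨ +-cong (split u) (*-congˡ (split v)) ⟨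
      f (u ∷ᵥ w ∷ᵥ X) + 1# * f (v ∷ᵥ w ∷ᵥ X)
        ≈⟨ linear F zero 1# (λ _ → refl) (λ { zero 0≢0 → contradiction ≡.refl 0≢0 ; (suc _) _ → ≋-refl })
                                         (λ { zero 0≢0 → contradiction ≡.refl 0≢0 ; (suc _) _ → ≋-refl }) ⟨
      f (w ∷ᵥ w ∷ᵥ X)
        ≈⟨ same w ⟩
      0# ∎)
      where
      w : Vector Carrier m
      -- The factor `1#` fits the shape required by `linear`.
      w j = u j + 1# * v j
      same : ∀ x → f (x ∷ᵥ x ∷ᵥ X) ≈ 0#
      same x = adjacent F zero (suc zero) ≡.refl ≋-refl
      split : ∀ x → f (x ∷ᵥ w ∷ᵥ X) ≈ f (x ∷ᵥ u ∷ᵥ X) + 1# * f (x ∷ᵥ v ∷ᵥ X)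
      split x = linear F (suc zero) 1# (λ _ → refl)
        (λ { zero _ → ≋-refl ; (suc zero) 1≢1 → contradiction ≡.refl 1≢1 ; (suc (suc _)) _ → ≋-refl })
        (λ { zero _ → ≋-refl ; (suc zero) 1≢1 → contradiction ≡.refl 1≢1 ; (suc (suc _)) _ → ≋-refl })
      expand : ∀ a b → a + b ≈ (0# + 1# * a) + 1# * (b + 1# * 0#)
      expand = solve 2 (λ a b → a :+ b := (con (+ 0) :+ con (+ 1) :* a) :+ con (+ 1) :* (b :+ con (+ 1) :* con (+ 0))) refl

  -- Swapping the first two rows moves the first row one place closer to its copy; the row now on
  -- top is frozen and the induction continues below it.
  alternating-head : ∀ {r m} {f : Matrix (suc r) m → Carrier} → MultiAlternating f →
                     ∀ k {X} → X zero ≋ X (suc k) → f X ≈ 0#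
  alternating-head         F zero    p = adjacent F zero (suc zero) ≡.refl p
  alternating-head {f = f} F (suc k) {X} p = begin
    f X                                            ≈⟨ cong F (λ { zero → ≋-refl ; (suc zero) → ≋-refl ; (suc (suc _)) → ≋-refl }) ⟩
    f (X zero ∷ᵥ X (suc zero) ∷ᵥ tail (tail X))      ≈⟨ swap F _ _ _ ⟩
    - f (X (suc zero) ∷ᵥ X zero ∷ᵥ tail (tail X))    ≈⟨ -‿cong (alternating-head (fix-head F (X (suc zero))) k p) ⟩
    - 0#                                           ≈⟨ -0#≈0# ⟩
    0#                                             ∎

  alternating : ∀ {r m} {f : Matrix r m → Carrier} → MultiAlternating f →
                ∀ i k → i ≢ k → ∀ {X} → X i ≋ X k → f X ≈ 0#
  alternating F zero    zero    i≢k p = contradiction ≡.refl i≢k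
  alternating F zero    (suc k) i≢k p = alternating-head F k p
  alternating F (suc i) zero    i≢k p = alternating-head F i (≋-sym p)
  alternating F (suc i) (suc k) i≢k {X} p =
    trans (cong F (∷-η X)) (alternating (fix-head F (X zero)) i k (i≢k ∘ ≡.cong suc) p)

  -- The rows are treated one at a time: linearity in a row splits off a term with `u` itself in
  -- that row, and `vanish` kills it.
  absorb : ∀ {r m} {f : Matrix r m → Carrier} → MultiAlternating f →
           ∀ (u : Vector Carrier m) → (∀ i {X} → X i ≋ u → f X ≈ 0#) →
           ∀ (d : Vector Carrier r) X → f (λ i j → X i j + d i * u j) ≈ f X
  absorb {zero}          F u vanish d X = cong F λ ()
  absorb {suc r} {f = f} F u vanish d X = begin
    f X⁺                                       ≈⟨ linear F zero (d zero) (λ _ → refl)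
                                                    (λ { zero 0≢0 → contradiction ≡.refl 0≢0 ; (suc _) _ → ≋-refl })
                                                    (λ { zero 0≢0 → contradiction ≡.refl 0≢0 ; (suc _) _ → ≋-refl }) ⟩
    f (X zero ∷ᵥ tail X⁺) + d zero * f (u ∷ᵥ tail X⁺)
                                               ≈⟨ +-congˡ (*-congˡ (vanish zero ≋-refl)) ⟩
    f (X zero ∷ᵥ tail X⁺) + d zero * 0#         ≈⟨ trans (+-congˡ (zeroʳ _)) (+-identityʳ _) ⟩
    f (X zero ∷ᵥ tail X⁺)                       ≈⟨ absorb (fix-head F (X zero)) u (λ i → vanish (suc i)) (tail d) (tail X) ⟩
    f (X zero ∷ᵥ tail X)                        ≈⟨ cong F (∷-η X) ⟨
    f X                                        ∎
    where
    X⁺ : Matrix (suc r) _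
    X⁺ i j = X i j + d i * u j

  -- This row operation serves twice: it clears a column in `det-unique`, and it is the shift of
  -- rows that makes partial Gauss sums vanish.
  add-head : ∀ {r m} {f : Matrix (suc r) m → Carrier} → MultiAlternating f →
             ∀ u (d : Vector Carrier r) X → f (u ∷ᵥ (λ i j → X i j + d i * u j)) ≈ f (u ∷ᵥ X)
  add-head F u = absorb (fix-head F u) u (λ i p → alternating-head F i (≋-sym p))

  infixl 8 _[_]≔_
  _[_]≔_ : ∀ {r m} → Matrix r m → Fin r → Vector Carrier m → Matrix r m
  X [ i ]≔ v = updateAt X i (const v)

  expand-row : ∀ {r m p} {f : Matrix r m → Carrier} → MultiAlternating f →
               ∀ X i (d : Vector Carrier p) (V : Matrix p m) →
               f (X [ i ]≔ (λ j → sum (λ k → d k * V k j))) ≈ sum (λ k → d k * f (X [ i ]≔ V k))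
  expand-row {r} {m} {p} {f} F X i = go
    where
    at : ∀ v → (X [ i ]≔ v) i ≋ v
    at v j = reflexive (≡.cong (λ w → w j) (updateAt-updates i X))
    away : ∀ v w k → k ≢ i → (X [ i ]≔ v) k ≋ (X [ i ]≔ w) k
    away v w k k≢i j = reflexive (≡.cong (λ u → u j)
      (≡.trans (updateAt-minimal k i X k≢i) (≡.sym (updateAt-minimal k i X k≢i))))
    row-linear : ∀ d {u v w} → (∀ j → u j ≈ v j + d * w j) →
                 f (X [ i ]≔ u) ≈ f (X [ i ]≔ v) + d * f (X [ i ]≔ w)
    row-linear d {u} {v} {w} eq = linear F i d
      (λ j → trans (at u j) (trans (eq j) (+-cong (sym (at v j)) (*-congˡ (sym (at w j))))))
      (away u v) (away u w)
    go : ∀ {p} (d : Vector Carrier p) (V : Matrix p m) →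
         f (X [ i ]≔ (λ j → sum (λ k → d k * V k j))) ≈ sum (λ k → d k * f (X [ i ]≔ V k))
    -- The empty combination is the zero row. Since 0 = 0 + (-1) 0, linearity gives f₀ = f₀ - f₀.
    go {zero} d V = begin
      f₀               ≈⟨ row-linear (- 1#) (λ j → cancel 0#) ⟩
      f₀ + - 1# * f₀   ≈⟨ cancel f₀ ⟨
      0#               ∎
      where
      f₀ = f (X [ i ]≔ (λ j → 0#))
      cancel : ∀ x → 0# ≈ x + - 1# * x
      cancel = solve 1 (λ x → con (+ 0) := x :+ :- con (+ 1) :* x) refl
    go {suc p} d V = begin
      f (X [ i ]≔ (λ j → sum (λ k → d k * V k j)))
        ≈⟨ row-linear (d zero) (λ j → +-comm _ _) ⟩
      f (X [ i ]≔ (λ j → sum (λ k → d (suc k) * V (suc k) j))) + d zero * f (X [ i ]≔ V zero)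
        ≈⟨ +-congʳ (go (tail d) (tail V)) ⟩
      sum (λ k → d (suc k) * f (X [ i ]≔ V (suc k))) + d zero * f (X [ i ]≔ V zero)
        ≈⟨ +-comm _ _ ⟩
      sum (λ k → d k * f (X [ i ]≔ V k)) ∎

  -- The Laplace expansion is multilinear and alternating.

  sgn : ∀ {m} → Fin m → Carrier
  sgn zero    = 1#
  sgn (suc j) = - sgn j

  minor : ∀ {r} → Matrix (suc r) (suc r) → Fin (suc r) → Matrix r r
  minor X j i k = X (suc i) (punchIn j k)

  det : ∀ {r} → Matrix r r → Carrier
  det {zero}  X = 1#
  det {suc r} X = sum (λ j → sgn j * X zero j * det (minor X j))

  det-cong : ∀ {r} {X Y : Matrix r r} → (∀ i → X i ≋ Y i) → det X ≈ det Y
  det-cong {zero}  p = refl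
  det-cong {suc r} p = sum-cong-≋ (λ j → *-cong (*-congˡ {sgn j} (p zero j)) (det-cong (λ i k → p (suc i) (punchIn j k))))

  det-linear : ∀ {r} i d {X Y Z : Matrix r r} → (∀ j → X i j ≈ Y i j + d * Z i j) →
               (∀ k → k ≢ i → X k ≋ Y k) → (∀ k → k ≢ i → X k ≋ Z k) →
               det X ≈ det Y + d * det Z
  det-linear {suc r} zero d {X} {Y} {Z} p q s = sum-linear d (λ j → begin
    sgn j * X zero j * det (minor X j)                                      ≈⟨ *-congʳ (*-congˡ (p j)) ⟩
    sgn j * (Y zero j + d * Z zero j) * det (minor X j)                     ≈⟨ distribute _ _ _ _ _ ⟩
    sgn j * Y zero j * det (minor X j) + d * (sgn j * Z zero j * det (minor X j))
      ≈⟨ +-cong (*-congˡ (det-cong (λ i k → q (suc i) (λ ()) (punchIn j k))))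
                (*-congˡ (*-congˡ (det-cong (λ i k → s (suc i) (λ ()) (punchIn j k))))) ⟩
    sgn j * Y zero j * det (minor Y j) + d * (sgn j * Z zero j * det (minor Z j)) ∎)
    where
    distribute : ∀ s y d z t → s * (y + d * z) * t ≈ s * y * t + d * (s * z * t)
    distribute = solve 5 (λ s y d z t → s :* (y :+ d :* z) :* t := s :* y :* t :+ d :* (s :* z :* t)) refl
  det-linear {suc r} (suc i) d {X} {Y} {Z} p q s = sum-linear d (λ j → begin
    sgn j * X zero j * det (minor X j)
      ≈⟨ *-congˡ (det-linear i d (λ k → p (punchIn j k))
           (λ k k≢i l → q (suc k) (k≢i ∘ suc-injective) (punchIn j l))
           (λ k k≢i l → s (suc k) (k≢i ∘ suc-injective) (punchIn j l))) ⟩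
    sgn j * X zero j * (det (minor Y j) + d * det (minor Z j))
      ≈⟨ distribute _ _ _ _ ⟩
    sgn j * X zero j * det (minor Y j) + d * (sgn j * X zero j * det (minor Z j))
      ≈⟨ +-cong (*-congʳ (*-congˡ (q zero (λ ()) j))) (*-congˡ (*-congʳ (*-congˡ (s zero (λ ()) j)))) ⟩
    sgn j * Y zero j * det (minor Y j) + d * (sgn j * Z zero j * det (minor Z j)) ∎)
    where
    distribute : ∀ s y d z → s * (y + d * z) ≈ s * y + d * (s * z)
    distribute = solve 4 (λ s y d z → s :* (y :+ d :* z) := s :* y :+ d :* (s :* z)) refl

  -- W j k stands for a weight of the ordered pair of columns (j , punchIn j k).
  Skew : ∀ {q} → (Fin (suc q) → Fin q → Carrier) → Set ℓ
  Skew {zero}  W = ⊤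
  Skew {suc q} W = (∀ k → W zero k + W (suc k) zero ≈ 0#) × Skew (λ j k → W (suc j) (suc k))

  Skew-resp : ∀ {q} {W W′ : Fin (suc q) → Fin q → Carrier} →
              (∀ j k → W j k ≈ W′ j k) → Skew W → Skew W′
  Skew-resp {zero}  eq _       = tt
  Skew-resp {suc q} eq (p , s) = (λ k → trans (sym (+-cong (eq _ _) (eq _ _))) (p k)) ,
                                 Skew-resp (λ j k → eq (suc j) (suc k)) s

  -- Row zero and column zero of the table hold the pairs (0 , k+1) and (k+1 , 0), which cancel; the
  -- rest is a smaller skew table.
  Skew-sum : ∀ {q} (W : Fin (suc q) → Fin q → Carrier) → Skew W → sum (λ j → sum (W j)) ≈ 0#
  Skew-sum {zero}  W _       = +-identityʳ 0#
  Skew-sum {suc q} W (p , s) = begin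
    sum (W zero) + sum (λ j → W (suc j) zero + sum (λ k → W (suc j) (suc k)))
      ≈⟨ +-congˡ (∑-distrib-+ (λ j → W (suc j) zero) (λ j → sum (λ k → W (suc j) (suc k)))) ⟩
    sum (W zero) + (sum (λ j → W (suc j) zero) + sum (λ j → sum (λ k → W (suc j) (suc k))))
      ≈⟨ +-congˡ (trans (+-congˡ (Skew-sum _ s)) (+-identityʳ _)) ⟩
    sum (W zero) + sum (λ j → W (suc j) zero)
      ≈⟨ ∑-distrib-+ (W zero) (λ j → W (suc j) zero) ⟨
    sum (λ k → W zero k + W (suc k) zero)
      ≈⟨ sum-zero (λ k → W zero k + W (suc k) zero) p ⟩
    0# ∎

  -- These are the terms of a double Laplace expansion whose first two rows both equal `a`. The
  -- complementary minor `E` is taken as a function of the selected columns: exchanging the two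
  -- removed columns leaves the selection unchanged and flips one sign, and the induction can vary
  -- the selection.
  Skew-laplace : ∀ {r} (a : Vector Carrier (suc (suc r))) (E : (Fin r → Fin (suc (suc r))) → Carrier) →
                 (∀ {p q} → (∀ x → p x ≡ q x) → E p ≈ E q) →
                 Skew (λ j k → sgn j * a j * (sgn k * a (punchIn j k) * E (λ x → punchIn j (punchIn k x))))
  Skew-laplace a E E-cong = (λ k → cancel _ _ _ _) , shifted a E E-cong
    where
    cancel : ∀ x y s e → 1# * x * (s * y * e) + (- s) * y * (1# * x * e) ≈ 0#
    cancel = solve 4 (λ x y s e → con (+ 1) :* x :* (s :* y :* e) :+ (:- s) :* y :* (con (+ 1) :* x :* e) := con (+ 0)) refl
    signs : ∀ s t x y e → s * x * (t * y * e) ≈ (- s) * x * ((- t) * y * e)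
    signs = solve 5 (λ s t x y e → s :* x :* (t :* y :* e) := (:- s) :* x :* ((:- t) :* y :* e)) refl
    lifts : ∀ {r} (j : Fin (suc (suc r))) (k : Fin (suc r)) (x : Fin (suc r)) →
            punchIn (suc j) (punchIn (suc k) x) ≡ (zero ∷ᵥ (λ y → suc (punchIn j (punchIn k y)))) x
    lifts j k zero    = ≡.refl
    lifts j k (suc x) = ≡.refl
    shifted : ∀ {r} (a : Vector Carrier (suc (suc r))) (E : (Fin r → Fin (suc (suc r))) → Carrier) →
              (∀ {p q} → (∀ x → p x ≡ q x) → E p ≈ E q) →
              Skew (λ (j : Fin (suc r)) (k : Fin r) → sgn (suc j) * a (suc j) *
                (sgn (suc k) * a (suc (punchIn j k)) * E (λ x → punchIn (suc j) (punchIn (suc k) x))))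
    shifted {zero}  a E E-cong = tt
    -- Passing to nonzero columns flips both signs, which cancel. Column zero then lies in every
    -- remaining selection, so `E` is precomposed with prepending `zero`.
    shifted {suc r} a E E-cong = Skew-resp
      (λ j k → trans (signs (sgn j) (sgn k) (a (suc j)) (a (suc (punchIn j k))) _)
                 (*-congˡ (*-congˡ (sym (E-cong (lifts j k))))))
      (Skew-laplace (tail a) (λ p → E (zero ∷ᵥ (suc ∘ p)))
        (λ p≗q → E-cong λ { zero → ≡.refl ; (suc x) → ≡.cong suc (p≗q x) }))

  -- For the two top rows, expanding twice gives a sum over ordered pairs of columns, which is skew.
  -- A lower pair of equal rows survives in every minor of the first row.
  det-adjacent : ∀ {r} (i k : Fin r) → toℕ k ≡ suc (toℕ i) → ∀ {X : Matrix r r} → X i ≋ X k → det X ≈ 0#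
  det-adjacent {suc (suc r)} zero (suc zero) _ {X} p = begin
    sum (λ j → sgn j * X zero j * sum (λ k → sgn k * X (suc zero) (punchIn j k) * E j k))
      ≈⟨ sum-cong-≋ (λ j → *-distribˡ-sum (sgn j * X zero j) (λ k → sgn k * X (suc zero) (punchIn j k) * E j k)) ⟩
    sum (λ j → sum (λ k → sgn j * X zero j * (sgn k * X (suc zero) (punchIn j k) * E j k)))
      ≈⟨ sum-cong-≋ (λ j → sum-cong-≋ (λ k →
           *-congˡ {sgn j * X zero j} (*-congʳ {E j k} (*-congˡ {sgn k} (p (punchIn j k)))))) ⟨
    sum (λ j → sum (W j))
      ≈⟨ Skew-sum W (Skew-laplace (X zero) (λ p → det (λ i x → X (suc (suc i)) (p x)))
           (λ p≗q → det-cong (λ i x → reflexive (≡.cong (X (suc (suc i))) (p≗q x))))) ⟩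
    0# ∎
    where
    E W : Fin (suc (suc r)) → Fin (suc r) → Carrier
    E j k = det (minor (minor X j) k)
    W j k = sgn j * X zero j * (sgn k * X zero (punchIn j k) * E j k)
  det-adjacent {suc r} (suc i) (suc k) k≡1+i {X} p = sum-zero (λ j → sgn j * X zero j * det (minor X j)) (λ j →
    trans (*-congˡ (det-adjacent i k (ℕ.suc-injective k≡1+i) (λ l → p (punchIn j l)))) (zeroʳ _))

  det-multiAlternating : ∀ {r} → MultiAlternating (det {r})
  det-multiAlternating = record { cong = det-cong ; linear = det-linear ; adjacent = det-adjacent }

  det-corner : ∀ {r} (X : Matrix (suc r) (suc r)) → (∀ j → X zero (suc j) ≈ 0#) →
               det X ≈ X zero zero * det (minor X zero)
  det-corner X p = trans (sum-head (λ j → sgn j * X zero j * det (minor X j))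
                             (λ j → trans (*-congʳ (trans (*-congˡ (p j)) (zeroʳ _))) (zeroˡ _)))
                         (*-congʳ (*-identityˡ _))

  det-δ : ∀ r → det (δ {r}) ≈ 1#
  det-δ zero    = refl
  det-δ (suc r) = trans (det-corner (δ {suc r}) (λ _ → refl)) (trans (*-identityˡ _) (det-δ r))

  -- Uniqueness of the determinant.

  -- Row `j` passes the j rows above it by one swap each.
  move-to-head : ∀ {r m} {f : Matrix (suc r) m → Carrier} → MultiAlternating f →
                 ∀ j X → f (X j ∷ᵥ (λ k → X (punchIn j k))) ≈ sgn j * f X
  move-to-head         F zero    X = trans (sym (cong F (∷-η X))) (sym (*-identityˡ _))
  move-to-head {suc r} {f = f} F (suc j) X = begin
    f (X (suc j) ∷ᵥ (λ k → X (punchIn (suc j) k)))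
      ≈⟨ cong F (λ { zero → ≋-refl ; (suc zero) → ≋-refl ; (suc (suc _)) → ≋-refl }) ⟩
    f (X (suc j) ∷ᵥ X zero ∷ᵥ (λ k → X (suc (punchIn j k))))
      ≈⟨ swap F _ _ _ ⟩
    - f (X zero ∷ᵥ X (suc j) ∷ᵥ (λ k → X (suc (punchIn j k))))
      ≈⟨ -‿cong (move-to-head (fix-head F (X zero)) j (tail X)) ⟩
    - (sgn j * f (X zero ∷ᵥ tail X))
      ≈⟨ -‿cong (*-congˡ (cong F (∷-η X))) ⟨
    - (sgn j * f X)
      ≈⟨ -‿distribˡ-* _ _ ⟩
    - sgn j * f X ∎

  -- Below a top row `δ j`, subtracting multiples of it erases column j of the other rows, so only
  -- the entries of the minor remain.
  clear-column : ∀ {m} (j : Fin (suc m)) (v : Vector Carrier (suc m)) →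
                 (λ l → v l + - v j * δ j l) ≋ insertAt (λ k → v (punchIn j k)) j 0#
  clear-column j v l with j ≟ l
  ... | yes ≡.refl = begin
    v j + - v j * 1#                               ≈⟨ +-congˡ (*-identityʳ _) ⟩
    v j + - v j                                    ≈⟨ -‿inverseʳ (v j) ⟩
    0#                                             ≡⟨ insertAt-lookup (λ k → v (punchIn j k)) j 0# ⟨
    insertAt (λ k → v (punchIn j k)) j 0# j        ∎
  ... | no j≢l = begin
    v l + - v j * 0#                               ≈⟨ trans (+-congˡ (zeroʳ _)) (+-identityʳ _) ⟩
    v l                                            ≡⟨ ≡.cong v (punchIn-punchOut j≢l) ⟨
    v (punchIn j (punchOut j≢l))                   ≡⟨ insertAt-punchIn (λ k → v (punchIn j k)) j 0# (punchOut j≢l) ⟨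
    insertAt (λ k → v (punchIn j k)) j 0# (punchIn j (punchOut j≢l))
                                                   ≡⟨ ≡.cong (insertAt (λ k → v (punchIn j k)) j 0#) (punchIn-punchOut j≢l) ⟩
    insertAt (λ k → v (punchIn j k)) j 0# l        ∎

  insertAt-cong : ∀ {m} (j : Fin (suc m)) {u v : Vector Carrier m} → u ≋ v →
                  insertAt u j 0# ≋ insertAt v j 0#
  insertAt-cong         zero    p zero    = refl
  insertAt-cong         zero    p (suc l) = p l
  insertAt-cong {suc m} (suc j) p zero    = p zero
  insertAt-cong {suc m} (suc j) p (suc l) = insertAt-cong j (λ k → p (suc k)) l

  insertAt-linear : ∀ {m} (j : Fin (suc m)) d {u v w : Vector Carrier m} → (∀ l → u l ≈ v l + d * w l) →
                    ∀ l → insertAt u j 0# l ≈ insertAt v j 0# l + d * insertAt w j 0# l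
  insertAt-linear         zero    d p zero    = sym (trans (+-identityˡ _) (zeroʳ d))
  insertAt-linear         zero    d p (suc l) = p l
  insertAt-linear {suc m} (suc j) d p zero    = p zero
  insertAt-linear {suc m} (suc j) d p (suc l) = insertAt-linear j d (λ k → p (suc k)) l

  insertAt-δ : ∀ {m} (j : Fin (suc m)) k → insertAt (δ k) j 0# ≋ δ (punchIn j k)
  insertAt-δ         zero    k       zero    = refl
  insertAt-δ         zero    k       (suc l) = refl
  insertAt-δ {suc m} (suc j) zero    zero    = refl
  insertAt-δ {suc m} (suc j) (suc k) zero    = refl
  insertAt-δ {suc m} (suc j) zero    (suc l) = trans (insertAt-cong j (λ _ → refl) l) (insertAt-0 j l)
    where
    insertAt-0 : ∀ {m} (j : Fin (suc m)) → insertAt (λ _ → 0#) j 0# ≋ (λ _ → 0#)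
    insertAt-0         zero    zero    = refl
    insertAt-0         zero    (suc l) = refl
    insertAt-0 {suc m} (suc j) zero    = refl
    insertAt-0 {suc m} (suc j) (suc l) = insertAt-0 j l
  insertAt-δ {suc m} (suc j) (suc k) (suc l) = insertAt-δ j k l

  -- The first row is expanded in unit vectors. With `δ k` on top, column k of the other rows can be
  -- cleared, so `f` becomes an alternating multilinear function of the minor. By induction it is a
  -- multiple of the minor's determinant; the factor is the value of `f` on the identity with row k
  -- moved to the top.
  det-unique : ∀ {r} {f : Matrix r r → Carrier} → MultiAlternating f → ∀ X → f X ≈ f δ * det X
  det-unique {zero}          F X = trans (cong F (λ ())) (sym (*-identityʳ _))
  det-unique {suc r} {f = f} F X = begin
    f X
      ≈⟨ cong F (λ { zero j → sym (sum-δ (X zero) j) ; (suc i) → ≋-refl }) ⟩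
    f (X [ zero ]≔ (λ j → sum (λ k → X zero k * δ k j)))
      ≈⟨ expand-row F X zero (X zero) δ ⟩
    sum (λ k → X zero k * f (X [ zero ]≔ δ k))
      ≈⟨ sum-cong-≋ (λ k → trans (*-congˡ (cofactor k)) (rearrange (X zero k) (sgn k) (f δ) (det (minor X k)))) ⟩
    sum (λ k → f δ * (sgn k * X zero k * det (minor X k)))
      ≈⟨ *-distribˡ-sum (f δ) (λ k → sgn k * X zero k * det (minor X k)) ⟨
    f δ * det X ∎
    where
    rearrange : ∀ x s a d → x * (s * a * d) ≈ a * (s * x * d)
    rearrange = solve 4 (λ x s a d → x :* (s :* a :* d) := a :* (s :* x :* d)) refl
    G : ∀ k → MultiAlternating (λ Z → f (δ k ∷ᵥ (λ i → insertAt (Z i) k 0#)))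
    G k = map-rows (fix-head F (δ k)) (λ v → insertAt v k 0#) (insertAt-linear k) (insertAt-cong k)
    cofactor : ∀ k → f (X [ zero ]≔ δ k) ≈ sgn k * f δ * det (minor X k)
    cofactor k = begin
      f (X [ zero ]≔ δ k)
        ≈⟨ cong F (λ { zero → ≋-refl ; (suc i) → ≋-refl }) ⟩
      f (δ k ∷ᵥ tail X)
        ≈⟨ add-head F (δ k) (λ i → - X (suc i) k) (tail X) ⟨
      f (δ k ∷ᵥ (λ i j → X (suc i) j + - X (suc i) k * δ k j))
        ≈⟨ cong (fix-head F (δ k)) (λ i → clear-column k (X (suc i))) ⟩
      f (δ k ∷ᵥ (λ i → insertAt (minor X k i) k 0#))
        ≈⟨ det-unique (G k) (minor X k) ⟩
      f (δ k ∷ᵥ (λ i → insertAt (δ i) k 0#)) * det (minor X k)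
        ≈⟨ *-congʳ (cong (fix-head F (δ k)) (λ i → insertAt-δ k i)) ⟩
      f (δ k ∷ᵥ (λ i → δ (punchIn k i))) * det (minor X k)
        ≈⟨ *-congʳ (move-to-head F k δ) ⟩
      sgn k * f δ * det (minor X k) ∎

  -- Multiplicativity and the adjugate.

  infixl 7 _⊠_
  _⊠_ : ∀ {r m p} → Matrix r m → Matrix m p → Matrix r p
  (X ⊠ Y) i j = sum (λ k → X i k * Y k j)

  -- For fixed `Y` the left side is alternating and multilinear in the rows of `X`, so uniqueness
  -- applies; its value at the identity is `det Y`.
  det-⊠ : ∀ {r} (X Y : Matrix r r) → det (X ⊠ Y) ≈ det X * det Y
  det-⊠ {r} X Y = begin
    det (X ⊠ Y)             ≈⟨ det-unique (map-rows det-multiAlternating (λ v j → sum (λ k → v k * Y k j))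
                                 (λ d p j → sum-linear d (λ k → trans (*-congʳ (p k)) (distribute _ _ _ _)))
                                 (λ p j → sum-cong-≋ (λ k → *-congʳ (p k)))) X ⟩
    det (δ ⊠ Y) * det X     ≈⟨ *-congʳ (det-cong δ⊠Y) ⟩
    det Y * det X           ≈⟨ *-comm _ _ ⟩
    det X * det Y           ∎
    where
    distribute : ∀ v d w y → (v + d * w) * y ≈ v * y + d * (w * y)
    distribute = solve 4 (λ v d w y → (v :+ d :* w) :* y := v :* y :+ d :* (w :* y)) refl
    δ⊠ : ∀ {m} i (y : Vector Carrier m) → sum (λ k → δ i k * y k) ≈ y i
    δ⊠ zero    y = trans (sum-head (λ k → δ zero k * y k) (λ k → zeroˡ _)) (*-identityˡ _)
    δ⊠ (suc i) y = trans (+-cong (zeroˡ _) (δ⊠ i (tail y))) (+-identityˡ _)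
    δ⊠Y : ∀ i → (δ ⊠ Y) i ≋ Y i
    δ⊠Y i j = δ⊠ i (λ k → Y k j)

  -- The cofactors are written as determinants of full size, so that `expand-row` applies to them
  -- without minors or signs.
  adjugate : ∀ {r} → Matrix r r → Matrix r r
  adjugate X k l = det (X [ l ]≔ δ k)

  -- Read backwards, the row expansion turns the entry into the determinant of `X` with row l
  -- replaced by row i: this is `X` itself if i = l, and has two equal rows otherwise.
  ⊠-adjugate : ∀ {r} (X : Matrix r r) i l → (X ⊠ adjugate X) i l ≈ det X * δ i l
  ⊠-adjugate X i l = begin
    sum (λ k → X i k * det (X [ l ]≔ δ k))
      ≈⟨ expand-row det-multiAlternating X l (X i) δ ⟨
    det (X [ l ]≔ (λ j → sum (λ k → X i k * δ k j)))
      ≈⟨ det-cong replace ⟩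
    det (X [ l ]≔ X i)
      ≈⟨ cases (i ≟ l) ⟩
    det X * δ i l ∎
    where
    replace : ∀ k → (X [ l ]≔ (λ j → sum (λ k → X i k * δ k j))) k ≋ (X [ l ]≔ X i) k
    replace k with k ≟ l
    ... | yes ≡.refl = λ j → begin
      (X [ l ]≔ (λ j → sum (λ k → X i k * δ k j))) l j   ≡⟨ ≡.cong (λ u → u j) (updateAt-updates l X) ⟩
      sum (λ k → X i k * δ k j)                          ≈⟨ sum-δ (X i) j ⟩
      X i j                                              ≡⟨ ≡.cong (λ u → u j) (updateAt-updates l X) ⟨
      (X [ l ]≔ X i) l j                                 ∎
    ... | no k≢l = λ j → reflexive (≡.cong (λ u → u j)
      (≡.trans (updateAt-minimal k l X k≢l) (≡.sym (updateAt-minimal k l X k≢l))))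
    cases : Dec (i ≡ l) → det (X [ l ]≔ X i) ≈ det X * δ i l
    cases (yes ≡.refl) = begin
      det (X [ l ]≔ X l)   ≈⟨ det-cong same ⟩
      det X                ≈⟨ *-identityʳ _ ⟨
      det X * 1#           ≡⟨ ≡.cong (det X *_) (δ-diag l) ⟨
      det X * δ l l        ∎
      where
      same : ∀ k → (X [ l ]≔ X l) k ≋ X k
      same k with k ≟ l
      ... | yes ≡.refl = λ j → reflexive (≡.cong (λ u → u j) (updateAt-updates l X))
      ... | no k≢l     = λ j → reflexive (≡.cong (λ u → u j) (updateAt-minimal k l X k≢l))
    cases (no i≢l) = begin
      det (X [ l ]≔ X i)   ≈⟨ alternating det-multiAlternating i l i≢l
                                (λ j → reflexive (≡.cong (λ u → u j)
                                  (≡.trans (updateAt-minimal i l X i≢l) (≡.sym (updateAt-updates l X))))) ⟩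
      0#                   ≈⟨ zeroʳ _ ⟨
      det X * 0#           ≡⟨ ≡.cong (det X *_) (δ-off i≢l) ⟨
      det X * δ i l        ∎

-- Exhaustive enumeration and Boolean tests.

-- A general relation in place of equality lets the lemma be nested: entries are matched by
-- equality, rows by pointwise equality.
allFuns-Any : ∀ {a b ℓ} {A : Set a} {B : Set b} (_~_ : A → B → Set ℓ) m (xs : List A) (f : Fin m → B) →
              (∀ i → Any (_~ f i) xs) → Any (λ g → ∀ i → g i ~ f i) (allFuns m xs)
allFuns-Any _~_ zero    xs f p = here λ ()
allFuns-Any _~_ (suc m) xs f p = Any.concatMap⁺ (λ x → map (x ∷ᵥ_) (allFuns m xs)) (Any.map
  (λ x~ → Any.map⁺ (Any.map (λ g~ → λ { zero → x~ ; (suc i) → g~ i })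
                            (allFuns-Any _~_ m xs (f ∘ suc) (p ∘ suc))))
  (p zero))

T-does⁺ : ∀ {a} {A : Set a} (d : Dec A) → A → T (does d)
T-does⁺ (yes _) _ = _
T-does⁺ (no ¬a) a = ¬a a

T-does⁻ : ∀ {a} {A : Set a} (d : Dec A) → T (does d) → A
T-does⁻ (yes a) _ = a

T-and⁺ : ∀ {bs} → All.All T bs → T (foldr _∧_ true bs)
T-and⁺ All.[]       = _
T-and⁺ (p All.∷ ps) = Equivalence.from T-∧ (p , T-and⁺ ps)

T-and⁻ : ∀ bs → T (foldr _∧_ true bs) → All.All T bs
T-and⁻ []       _ = All.[]
T-and⁻ (b ∷ bs) t = proj₁ (Equivalence.to (T-∧ {b}) t) All.∷ T-and⁻ bs (proj₂ (Equivalence.to (T-∧ {b}) t))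

-- The ring of residues modulo n.

module Residues (n : ℕ) .{{_ : NonZero n}} where
  open Zmod n hiding (det)
  open ≡ using (refl; sym; trans; cong; cong₂)
  open ≡.≡-Reasoning

  infixl 6 _+ₙ_
  _+ₙ_ : Zn → Zn → Zn
  x +ₙ y = [ toℕ x ℕ.+ toℕ y ]ₙ

  -ₙ_ : Zn → Zn
  -ₙ x = [ n ℕ.∸ toℕ x ]ₙ

  toℕ-[] : ∀ k → toℕ [ k ]ₙ ≡ k ℕ.% n
  toℕ-[] k = toℕ-fromℕ< (ℕ.m%n<n k n)

  []-cong : ∀ {j k} → j ℕ.% n ≡ k ℕ.% n → [ j ]ₙ ≡ [ k ]ₙ
  []-cong {j} {k} eq = toℕ-injective (trans (toℕ-[] j) (trans eq (sym (toℕ-[] k))))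

  []-zero : ∀ {k} → k ℕ.% n ≡ 0 → [ k ]ₙ ≡ [ 0 ]ₙ
  []-zero eq = []-cong (trans eq (sym (ℕ.m*n%n≡0 0 n)))

  []-toℕ : ∀ x → [ toℕ x ]ₙ ≡ x
  []-toℕ x = toℕ-injective (trans (toℕ-[] (toℕ x)) (ℕ.m<n⇒m%n≡m (toℕ<n x)))

  []-+ : ∀ j k → [ j ]ₙ +ₙ [ k ]ₙ ≡ [ j ℕ.+ k ]ₙ
  []-+ j k = []-cong (trans (cong₂ (λ u v → (u ℕ.+ v) ℕ.% n) (toℕ-[] j) (toℕ-[] k)) (sym (ℕ.%-distribˡ-+ j k n)))

  []-* : ∀ j k → [ j ]ₙ ·ₙ [ k ]ₙ ≡ [ j ℕ.* k ]ₙ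
  []-* j k = []-cong (trans (cong₂ (λ u v → (u ℕ.* v) ℕ.% n) (toℕ-[] j) (toℕ-[] k)) (sym (ℕ.%-distribˡ-* j k n)))

  []-+ˡ : ∀ j y → [ j ]ₙ +ₙ y ≡ [ j ℕ.+ toℕ y ]ₙ
  []-+ˡ j y = trans (cong ([ j ]ₙ +ₙ_) (sym ([]-toℕ y))) ([]-+ j (toℕ y))

  []-+ʳ : ∀ x k → x +ₙ [ k ]ₙ ≡ [ toℕ x ℕ.+ k ]ₙ
  []-+ʳ x k = trans (cong (_+ₙ [ k ]ₙ) (sym ([]-toℕ x))) ([]-+ (toℕ x) k)

  []-*ˡ : ∀ j y → [ j ]ₙ ·ₙ y ≡ [ j ℕ.* toℕ y ]ₙ
  []-*ˡ j y = trans (cong ([ j ]ₙ ·ₙ_) (sym ([]-toℕ y))) ([]-* j (toℕ y))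

  []-*ʳ : ∀ x k → x ·ₙ [ k ]ₙ ≡ [ toℕ x ℕ.* k ]ₙ
  []-*ʳ x k = trans (cong (_·ₙ [ k ]ₙ) (sym ([]-toℕ x))) ([]-* (toℕ x) k)

  +ₙ-assoc : ∀ x y z → (x +ₙ y) +ₙ z ≡ x +ₙ (y +ₙ z)
  +ₙ-assoc x y z = trans ([]-+ˡ _ z) (trans (cong [_]ₙ (ℕ.+-assoc (toℕ x) (toℕ y) (toℕ z))) (sym ([]-+ʳ x _)))

  +ₙ-comm : ∀ x y → x +ₙ y ≡ y +ₙ x
  +ₙ-comm x y = cong [_]ₙ (ℕ.+-comm (toℕ x) (toℕ y))

  +ₙ-identityˡ : ∀ x → [ 0 ]ₙ +ₙ x ≡ x
  +ₙ-identityˡ x = trans ([]-+ˡ 0 x) ([]-toℕ x)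

  -ₙ-inverseˡ : ∀ x → (-ₙ x) +ₙ x ≡ [ 0 ]ₙ
  -ₙ-inverseˡ x = trans ([]-+ˡ _ x) ([]-zero (trans (cong (ℕ._% n) (ℕ.m∸n+n≡m (ℕ.<⇒≤ (toℕ<n x)))) (ℕ.n%n≡0 n)))

  ·ₙ-assoc : ∀ x y z → (x ·ₙ y) ·ₙ z ≡ x ·ₙ (y ·ₙ z)
  ·ₙ-assoc x y z = trans ([]-*ˡ _ z) (trans (cong [_]ₙ (ℕ.*-assoc (toℕ x) (toℕ y) (toℕ z))) (sym ([]-*ʳ x _)))

  ·ₙ-comm : ∀ x y → x ·ₙ y ≡ y ·ₙ x
  ·ₙ-comm x y = cong [_]ₙ (ℕ.*-comm (toℕ x) (toℕ y))

  ·ₙ-identityˡ : ∀ x → oneₙ ·ₙ x ≡ x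
  ·ₙ-identityˡ x = trans ([]-*ˡ 1 x) (trans (cong [_]ₙ (ℕ.*-identityˡ (toℕ x))) ([]-toℕ x))

  ·ₙ-distribˡ-+ₙ : ∀ x y z → x ·ₙ (y +ₙ z) ≡ (x ·ₙ y) +ₙ (x ·ₙ z)
  ·ₙ-distribˡ-+ₙ x y z = trans ([]-*ʳ x _) (trans (cong [_]ₙ (ℕ.*-distribˡ-+ (toℕ x) (toℕ y) (toℕ z))) (sym ([]-+ (toℕ x ℕ.* toℕ y) _)))

  residueRing : CommutativeRing 0ℓ 0ℓ
  residueRing = record
    { Carrier = Zn ; _≈_ = _≡_ ; _+_ = _+ₙ_ ; _*_ = _·ₙ_ ; -_ = -ₙ_ ; 0# = [ 0 ]ₙ ; 1# = oneₙ
    ; isCommutativeRing = record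
      { isRing = record
        { +-isAbelianGroup = record
          { isGroup = record
            { isMonoid = record
              { isSemigroup = record
                { isMagma = record { isEquivalence = ≡.isEquivalence ; ∙-cong = cong₂ _+ₙ_ }
                ; assoc = +ₙ-assoc }
              ; identity = +ₙ-identityˡ , λ x → trans (+ₙ-comm x _) (+ₙ-identityˡ x) }
            ; inverse = -ₙ-inverseˡ , λ x → trans (+ₙ-comm x _) (-ₙ-inverseˡ x)
            ; ⁻¹-cong = cong -ₙ_ }
          ; comm = +ₙ-comm }
        ; *-cong = cong₂ _·ₙ_
        ; *-assoc = ·ₙ-assoc
        ; *-identity = ·ₙ-identityˡ , λ x → trans (·ₙ-comm x _) (·ₙ-identityˡ x)
        ; distrib = ·ₙ-distribˡ-+ₙ , λ x y z → trans (·ₙ-comm _ x) (trans (·ₙ-distribˡ-+ₙ x y z) (cong₂ _+ₙ_ (·ₙ-comm x y) (·ₙ-comm x z))) }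
      ; *-comm = ·ₙ-comm } }

  open CommutativeRing residueRing public using (0#; +-identityʳ; *-identityʳ; zeroˡ; zeroʳ; semiring)
  open IntegerMultiples residueRing using (ι; ι-+; ι-*)
  open Determinant residueRing public
  private module Mult = Algebra.Properties.Semiring.Mult.TCOptimised semiring
  open Algebra.Properties.AbelianGroup (CommutativeRing.+-abelianGroup residueRing) using (inverseˡ-unique)

  ι-pos : ∀ k → ι (+ k) ≡ [ k ]ₙ
  ι-pos zero    = refl
  ι-pos (suc k) = trans (Mult.1+× k oneₙ) (trans (cong (oneₙ +ₙ_) (ι-pos k)) ([]-+ 1 k))

  -- The cases follow `%ℕ` on a negative integer: 0 if n divides k + 1, and n minus the remainder
  -- otherwise.
  -[1+]-complement : ∀ k → (-[1+ k ] %ℕ n ℕ.+ suc k) ℕ.% n ≡ 0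
  -[1+]-complement k with suc k ℕ.% n in eq
  ... | zero  = eq
  ... | suc r = begin
    (n ℕ.∸ suc r ℕ.+ suc k) ℕ.% n                        ≡⟨ ℕ.%-distribˡ-+ (n ℕ.∸ suc r) (suc k) n ⟩
    ((n ℕ.∸ suc r) ℕ.% n ℕ.+ suc k ℕ.% n) ℕ.% n          ≡⟨ cong (λ u → ((n ℕ.∸ suc r) ℕ.% n ℕ.+ u) ℕ.% n) (ℕ.m%n%n≡m%n (suc k) n) ⟨
    ((n ℕ.∸ suc r) ℕ.% n ℕ.+ suc k ℕ.% n ℕ.% n) ℕ.% n    ≡⟨ cong (λ u → ((n ℕ.∸ suc r) ℕ.% n ℕ.+ u ℕ.% n) ℕ.% n) eq ⟩
    ((n ℕ.∸ suc r) ℕ.% n ℕ.+ suc r ℕ.% n) ℕ.% n          ≡⟨ ℕ.%-distribˡ-+ (n ℕ.∸ suc r) (suc r) n ⟨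
    (n ℕ.∸ suc r ℕ.+ suc r) ℕ.% n                        ≡⟨ cong (ℕ._% n) (ℕ.m∸n+n≡m (≡.subst (ℕ._≤ n) eq (ℕ.<⇒≤ (ℕ.m%n<n (suc k) n)))) ⟩
    n ℕ.% n                                              ≡⟨ ℕ.n%n≡0 n ⟩
    0                                                    ∎

  -- Once reduction is identified with `ι`, its compatibility with sums and products of signed
  -- integers needs no further case analysis.
  []ᵢ≡ι : ∀ z → [ z ]ᵢ ≡ ι z
  []ᵢ≡ι (+ k)    = trans ([]-cong (ℕ.m%n%n≡m%n k n)) (sym (ι-pos k))
  []ᵢ≡ι -[1+ k ] = inverseˡ-unique _ _ (begin
    [ -[1+ k ] %ℕ n ]ₙ +ₙ ι (+ suc k)   ≡⟨ cong ([ -[1+ k ] %ℕ n ]ₙ +ₙ_) (ι-pos (suc k)) ⟩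
    [ -[1+ k ] %ℕ n ]ₙ +ₙ [ suc k ]ₙ    ≡⟨ []-+ _ _ ⟩
    [ -[1+ k ] %ℕ n ℕ.+ suc k ]ₙ        ≡⟨ []-zero (-[1+]-complement k) ⟩
    0#                                  ∎)

  toℕ-0# : toℕ 0# ≡ 0
  toℕ-0# = trans (toℕ-[] 0) (ℕ.m*n%n≡0 0 n)

  -- The left side is the exponent in `addChar`; the right side lets it be handled by ring laws
  -- modulo n.
  []ᵢ-·ₙ : ∀ z x → (z ℤ.* + toℕ x) %ℕ n ≡ toℕ ([ z ]ᵢ ·ₙ x)
  []ᵢ-·ₙ z x = begin
    (z ℤ.* + toℕ x) %ℕ n             ≡⟨ ℕ.m<n⇒m%n≡m (ℤ.n%ℕd<d (z ℤ.* + toℕ x) n) ⟨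
    (z ℤ.* + toℕ x) %ℕ n ℕ.% n       ≡⟨ toℕ-[] _ ⟨
    toℕ [ z ℤ.* + toℕ x ]ᵢ           ≡⟨ cong toℕ ([]ᵢ≡ι (z ℤ.* + toℕ x)) ⟩
    toℕ (ι (z ℤ.* + toℕ x))          ≡⟨ cong toℕ (ι-* z (+ toℕ x)) ⟩
    toℕ (ι z ·ₙ ι (+ toℕ x))         ≡⟨ cong₂ (λ u v → toℕ (u ·ₙ v)) (sym ([]ᵢ≡ι z)) (trans (ι-pos (toℕ x)) ([]-toℕ x)) ⟩
    toℕ ([ z ]ᵢ ·ₙ x)                ∎

  -- A zero residue means that n divides the product of z and the representative of x; by
  -- coprimality n divides that representative.
  []ᵢ-·ₙ-cancel : ∀ z → gcd ∣ z ∣ n ≡ 1 → ∀ x → toℕ ([ z ]ᵢ ·ₙ x) ≡ 0 → x ≡ 0#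
  []ᵢ-·ₙ-cancel z z⊥n x zx≡0 = trans (sym ([]-toℕ x)) ([]-zero (ℕ.n∣m⇒m%n≡0 (toℕ x) n
    (coprime-divisor (Coprimality.sym (gcd≡1⇒coprime {∣ z ∣} z⊥n)) (ℕ.divides ∣ q ∣ (begin
      ∣ z ∣ ℕ.* toℕ x                     ≡⟨ ℤ.abs-* z (+ toℕ x) ⟨
      ∣ z ℤ.* + toℕ x ∣                   ≡⟨ cong ∣_∣ (ℤ.a≡a%ℕn+[a/ℕn]*n (z ℤ.* + toℕ x) n) ⟩
      ∣ + ((z ℤ.* + toℕ x) %ℕ n) ℤ.+ q ℤ.* + n ∣
                                          ≡⟨ cong (λ k → ∣ + k ℤ.+ q ℤ.* + n ∣) (trans ([]ᵢ-·ₙ z x) zx≡0) ⟩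
      ∣ + 0 ℤ.+ q ℤ.* + n ∣               ≡⟨ cong ∣_∣ (ℤ.+-identityˡ (q ℤ.* + n)) ⟩
      ∣ q ℤ.* + n ∣                       ≡⟨ ℤ.abs-* q (+ n) ⟩
      ∣ q ∣ ℕ.* n                         ∎)))))
    where q = (z ℤ.* + toℕ x) /ℕ n

  -- The integer determinant reduced modulo n.

  sgnℤ : ℕ → ℤ
  sgnℤ zero          = + 1
  sgnℤ (suc zero)    = ℤ.- (+ 1)
  sgnℤ (suc (suc k)) = sgnℤ k

  term : ∀ {r} → (Fin (suc r) → Fin (suc r) → ℤ) → Fin (suc r) → ℤ
  term A j = sgnℤ (toℕ j) ℤ.* A zero j ℤ.* detℤ (λ i k → A (suc i) (punchIn j k))

  -- A named counterpart of the local loop `go` of `detℤ`, open to induction; `js` lists the columns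
  -- still to be expanded.
  terms : ∀ r → (Fin (suc r) → Fin (suc r) → ℤ) → ∀ m → (Fin m → Fin (suc r)) → ℤ
  terms r A zero    js = + 0
  terms r A (suc m) js = term A (js zero) ℤ.+ terms r A m (λ i → js (suc i))

  -- The local functions of detℤ cannot be named here.  The underscores below
  -- stand for them; they are solved by the uses of these signatures, where
  -- with-abstraction has turned all arguments into distinct variables.
  go-terms : ∀ r (A : Fin (suc r) → Fin (suc r) → ℤ) m (js : Fin m → Fin (suc r)) → _ ≡ terms r A m js
  go-tail  : ∀ r (A : Fin (suc (suc r)) → Fin (suc (suc r)) → ℤ) →
             _ ≡ terms (suc r) A r (λ i → suc (suc i))
  sign-sgn : ∀ r (A : Fin (suc r) → Fin (suc r) → ℤ) k (x d g : ℤ) → _ ≡ sgnℤ k ℤ.* x ℤ.* d ℤ.+ g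

  detℤ-laplace : ∀ r (A : Fin (suc r) → Fin (suc r) → ℤ) → detℤ A ≡ terms r A (suc r) id
  detℤ-laplace zero    A = refl
  -- With two visible successors the local loop unfolds by two terms and stops at the variable `r`;
  -- what is left is the left side of `go-tail`.
  detℤ-laplace (suc r) A = cong (λ z → term A zero ℤ.+ (term A (suc zero) ℤ.+ z)) (go-tail r A)

  go-tail r A with suc r | A | (λ (i : Fin r) → Fin.suc {suc r} (suc i))
  ... | r′ | A′ | js = go-terms r′ A′ r js

  go-terms r A zero    js = refl
  go-terms r A (suc m) js rewrite go-terms r A m (λ i → js (suc i))
    with toℕ (js zero) | A zero (js zero) | detℤ (λ i k → A (suc i) (punchIn (js zero) k)) | terms r A m (λ i → js (suc i))
  ... | k | x | d | g = sign-sgn r A k x d g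

  sign-sgn r A zero          x d g = refl
  sign-sgn r A (suc zero)    x d g = refl
  sign-sgn r A (suc (suc k)) x d g = sign-sgn r A k x d g

  ι-sgnℤ-suc : ∀ k → ι (sgnℤ (suc k)) ≡ -ₙ ι (sgnℤ k)
  ι-sgnℤ-suc zero          = refl
  ι-sgnℤ-suc (suc zero)    = inverseˡ-unique _ _ (CommutativeRing.-‿inverseʳ residueRing oneₙ)
  ι-sgnℤ-suc (suc (suc k)) = ι-sgnℤ-suc k

  ι-sgnℤ : ∀ {m} (j : Fin m) → ι (sgnℤ (toℕ j)) ≡ sgn j
  ι-sgnℤ zero    = refl
  ι-sgnℤ (suc j) = trans (ι-sgnℤ-suc (toℕ j)) (cong -ₙ_ (ι-sgnℤ j))

  ι-terms : ∀ r A m js → ι (terms r A m js) ≡ sum (λ i → ι (term A (js i)))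
  ι-terms r A zero    js = refl
  ι-terms r A (suc m) js = trans (ι-+ (term A (js zero)) _) (cong (ι (term A (js zero)) +ₙ_) (ι-terms r A m (js ∘ suc)))

  ι-detℤ : ∀ r (A : Fin r → Fin r → ℤ) → ι (detℤ A) ≡ det (λ i j → ι (A i j))
  ι-detℤ zero    A = refl
  ι-detℤ (suc r) A = trans (cong ι (detℤ-laplace r A)) (trans (ι-terms r A (suc r) id) (sum-cong-≋ ι-term))
    where
    ι-term : ∀ j → ι (term A j) ≡ (sgn j ·ₙ ι (A zero j)) ·ₙ det (λ i k → ι (A (suc i) (punchIn j k)))
    ι-term j = trans (ι-* (sgnℤ (toℕ j) ℤ.* A zero j) _)
      (cong₂ _·ₙ_ (trans (ι-* (sgnℤ (toℕ j)) _) (cong (_·ₙ ι (A zero j)) (ι-sgnℤ j))) (ι-detℤ r _))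

  det≡ : ∀ {r} (X : Mat r) → Zmod.det n X ≡ det X
  det≡ {r} X = trans ([]ᵢ≡ι (detℤ (λ i j → + toℕ (X i j))))
    (trans (ι-detℤ r (λ i j → + toℕ (X i j))) (det-cong (λ i j → trans (ι-pos (toℕ (X i j))) ([]-toℕ (X i j)))))

  [sumℕ] : ∀ {m} (f : Fin m → ℕ) → [ sumℕ f ]ₙ ≡ sum (λ i → [ f i ]ₙ)
  [sumℕ] {zero}  f = refl
  [sumℕ] {suc m} f = trans (sym ([]-+ (f zero) _)) (cong ([ f zero ]ₙ +ₙ_) ([sumℕ] (f ∘ suc)))

  tr≡ : ∀ {r} (X : Mat r) → tr X ≡ sum (λ i → X i i)
  tr≡ X = trans ([sumℕ] (λ i → toℕ (X i i))) (sum-cong-≋ (λ i → []-toℕ (X i i)))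

  ⊗≡⊠ : ∀ {r} (X Y : Mat r) i j → (X ⊗ Y) i j ≡ (X ⊠ Y) i j
  ⊗≡⊠ X Y i j = [sumℕ] (λ k → toℕ (X i k) ℕ.* toℕ (Y k j))

  idMat≡δ : ∀ {r} (i j : Fin r) → idMat i j ≡ δ i j
  idMat≡δ i j with does (i ≟ j)
  ... | true  = refl
  ... | false = refl

  -- Units of ℤ/n and invertible matrices.

  unit⁺ : ∀ {x y} → x ·ₙ y ≡ oneₙ → T (isUnit x)
  unit⁺ {x} {y} xy≡1 = Any.any⁺ _ (lose (∈-allFin y) (T-does⁺ ((x ·ₙ y) ≟ oneₙ) xy≡1))

  unit⁻ : ∀ {x} → T (isUnit x) → ∃ λ y → x ·ₙ y ≡ oneₙ
  unit⁻ {x} t with Any.satisfied (Any.any⁻ _ elems t)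
  ... | y , p = y , T-does⁻ ((x ·ₙ y) ≟ oneₙ) p

  unit-*⁻ : ∀ x y → T (isUnit (x ·ₙ y)) → T (isUnit x) × T (isUnit y)
  unit-*⁻ x y t with unit⁻ {x ·ₙ y} t
  ... | z , xyz≡1 = unit⁺ {x} {y ·ₙ z} (trans (sym (·ₙ-assoc x y z)) xyz≡1) ,
                    unit⁺ {y} {x ·ₙ z} (trans (sym (·ₙ-assoc y x z)) (trans (cong (_·ₙ z) (·ₙ-comm y x)) xyz≡1))

  unit-*⁺ : ∀ x y → T (isUnit x) → T (isUnit y) → T (isUnit (x ·ₙ y))
  unit-*⁺ x y s t with unit⁻ {x} s | unit⁻ {y} t
  ... | x′ , xx′≡1 | y′ , yy′≡1 = unit⁺ {x ·ₙ y} {y′ ·ₙ x′} (begin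
    (x ·ₙ y) ·ₙ (y′ ·ₙ x′)   ≡⟨ ·ₙ-assoc x y _ ⟩
    x ·ₙ (y ·ₙ (y′ ·ₙ x′))   ≡⟨ cong (x ·ₙ_) (·ₙ-assoc y y′ x′) ⟨
    x ·ₙ ((y ·ₙ y′) ·ₙ x′)   ≡⟨ cong (λ u → x ·ₙ (u ·ₙ x′)) yy′≡1 ⟩
    x ·ₙ (oneₙ ·ₙ x′)        ≡⟨ cong (x ·ₙ_) (·ₙ-identityˡ x′) ⟩
    x ·ₙ x′                  ≡⟨ xx′≡1 ⟩
    oneₙ                     ∎)

  eqMat⁺ : ∀ {r} {X Y : Mat r} → (∀ i j → X i j ≡ Y i j) → T (eqMatᵇ X Y)
  eqMat⁺ {X = X} {Y} p = T-and⁺ (All.concat⁺ (All.map⁺ (All.tabulate⁺ (λ i →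
    All.map⁺ (All.tabulate⁺ (λ j → T-does⁺ (X i j ≟ Y i j) (p i j)))))))

  eqMat⁻ : ∀ {r} {X Y : Mat r} → T (eqMatᵇ X Y) → ∀ i j → X i j ≡ Y i j
  eqMat⁻ {r} {X} {Y} t i j = T-does⁻ (X i j ≟ Y i j) (All.tabulate⁻ (All.map⁻ (All.tabulate⁻ (All.map⁻ (All.concat⁻
    {xss = map (λ i → map (λ j → does (X i j ≟ Y i j)) (allFin r)) (allFin r)} (T-and⁻ _ t))) i)) j)

  invertible⇒unit-det : ∀ {r} {X : Mat r} → T (isInvertible X) → T (isUnit (det X))
  invertible⇒unit-det {r} {X} t with Any.satisfied (Any.any⁻ _ (allMats r) t)
  ... | Y , p = unit⁺ {det X} {det Y} (begin
    det X ·ₙ det Y   ≡⟨ det-⊠ X Y ⟨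
    det (X ⊠ Y)      ≡⟨ det-cong (λ i j → trans (sym (⊗≡⊠ X Y i j)) (trans (eqMat⁻ {X = X ⊗ Y} p i j) (idMat≡δ i j))) ⟩
    det (δ {r})      ≡⟨ det-δ r ⟩
    oneₙ             ∎)

  -- The right inverse is the adjugate scaled by the inverse `d` of the determinant. The search list
  -- contains it up to pointwise equality, which suffices for the test `eqMatᵇ`.
  unit-det⇒invertible : ∀ {r} {X : Mat r} → T (isUnit (det X)) → T (isInvertible X)
  unit-det⇒invertible {r} {X} t with unit⁻ {det X} t
  ... | d , det-d≡1 = Any.any⁺ _ (Any.map
    (λ {Y} Y~ → eqMat⁺ (λ i j → begin
      (X ⊗ Y) i j                                         ≡⟨ ⊗≡⊠ X Y i j ⟩
      sum (λ k → X i k ·ₙ Y k j)                          ≡⟨ sum-cong-≋ (λ k → trans (cong (X i k ·ₙ_) (Y~ k j)) (sym (·ₙ-assoc (X i k) _ d))) ⟩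
      sum (λ k → (X i k ·ₙ adjugate X k j) ·ₙ d)          ≡⟨ *-distribʳ-sum d (λ k → X i k ·ₙ adjugate X k j) ⟨
      (X ⊠ adjugate X) i j ·ₙ d                           ≡⟨ cong (_·ₙ d) (⊠-adjugate X i j) ⟩
      (det X ·ₙ δ i j) ·ₙ d                               ≡⟨ cong (_·ₙ d) (·ₙ-comm (det X) (δ i j)) ⟩
      (δ i j ·ₙ det X) ·ₙ d                               ≡⟨ ·ₙ-assoc (δ i j) (det X) d ⟩
      δ i j ·ₙ (det X ·ₙ d)                               ≡⟨ cong (δ i j ·ₙ_) det-d≡1 ⟩
      δ i j ·ₙ oneₙ                                       ≡⟨ *-identityʳ (δ i j) ⟩
      δ i j                                               ≡⟨ idMat≡δ i j ⟨
      idMat i j                                           ∎))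
    (allFuns-Any (λ u v → ∀ j → u j ≡ v j) r (allFuns r elems) (λ k j → adjugate X k j ·ₙ d)
      (λ k → allFuns-Any _≡_ r elems _ (λ j → Any.map sym (∈-allFin _)))))

  isInvertible≡isUnit-det : ∀ {r} (X : Mat r) → isInvertible X ≡ isUnit (Zmod.det n X)
  isInvertible≡isUnit-det X = trans (T-ext (invertible⇒unit-det {X = X}) (unit-det⇒invertible {X = X})) (cong isUnit (sym (det≡ X)))
    where
    T-ext : ∀ {a b} → (T a → T b) → (T b → T a) → a ≡ b
    T-ext {false} {false} f g = refl
    T-ext {true}  {true}  f g = refl
    T-ext {false} {true}  f g with () ← g _
    T-ext {true}  {false} f g with () ← f _

-- Sums over lists and over enumerated functions.

module ListSums {c ℓ} (R : CommutativeRing c ℓ) where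
  open CommutativeRing R hiding (zero)
  open InRing R
  open Determinant R using (sum; sum-permute; sum-zero)
  open Algebra.Properties.CommutativeSemigroup *-commutativeSemigroup using (x∙yz≈y∙xz)
  open SetoidReasoning setoid

  module _ {a} {A : Set a} where
    Σ-cong : ∀ (xs : List A) {f g} → (∀ x → f x ≈ g x) → ΣR xs f ≈ ΣR xs g
    Σ-cong []       p = refl
    Σ-cong (x ∷ xs) p = +-cong (p x) (Σ-cong xs p)

    Σ-++ : ∀ (xs ys : List A) f → ΣR (xs ++ ys) f ≈ ΣR xs f + ΣR ys f
    Σ-++ []       ys f = sym (+-identityˡ _)
    Σ-++ (x ∷ xs) ys f = trans (+-congˡ (Σ-++ xs ys f)) (sym (+-assoc _ _ _))

    Σ-distribˡ : ∀ (xs : List A) d f → ΣR xs (λ x → d * f x) ≈ d * ΣR xs f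
    Σ-distribˡ []       d f = sym (zeroʳ d)
    Σ-distribˡ (x ∷ xs) d f = trans (+-congˡ (Σ-distribˡ xs d f)) (sym (distribˡ d _ _))

    Σ-distribʳ : ∀ (xs : List A) d f → ΣR xs (λ x → f x * d) ≈ ΣR xs f * d
    Σ-distribʳ []       d f = sym (zeroˡ d)
    Σ-distribʳ (x ∷ xs) d f = trans (+-congˡ (Σ-distribʳ xs d f)) (sym (distribʳ d _ _))

    Σ-const : ∀ (xs : List A) d → ΣR xs (λ _ → d) ≈ ℕ→R (length xs) * d
    Σ-const []       d = sym (zeroˡ d)
    Σ-const (x ∷ xs) d = trans (+-cong (sym (*-identityˡ d)) (Σ-const xs d)) (sym (distribʳ d _ _))

    Σ-filter : ∀ (p : A → Bool) xs f → ΣR (filter (T? ∘ p) xs) f ≈ ΣR xs (λ x → if p x then f x else 0#)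
    Σ-filter p []       f = refl
    Σ-filter p (x ∷ xs) f with p x
    ... | true  = +-congˡ (Σ-filter p xs f)
    ... | false = trans (Σ-filter p xs f) (sym (+-identityˡ _))

    Σ-tabulate : ∀ {m} (g : Fin m → A) f → ΣR (tabulate g) f ≡ sum (f ∘ g)
    Σ-tabulate {zero}  g f = ≡.refl
    Σ-tabulate {suc m} g f = ≡.cong (λ s → f (g zero) + s) (Σ-tabulate (g ∘ suc) f)

    Σ-map : ∀ {b} {B : Set b} (g : B → A) xs f → ΣR (map g xs) f ≡ ΣR xs (f ∘ g)
    Σ-map g []       f = ≡.refl
    Σ-map g (x ∷ xs) f = ≡.cong (λ s → f (g x) + s) (Σ-map g xs f)

    Σ-concatMap : ∀ {b} {B : Set b} (g : B → List A) xs f → ΣR (concatMap g xs) f ≈ ΣR xs (λ x → ΣR (g x) f)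
    Σ-concatMap g []       f = refl
    Σ-concatMap g (x ∷ xs) f = trans (Σ-++ (g x) _ f) (+-congˡ (Σ-concatMap g xs f))

  Σ-allFuns : ∀ {a} {A : Set a} m (xs : List A) F →
              ΣR (allFuns (suc m) xs) F ≈ ΣR xs (λ x → ΣR (allFuns m xs) (λ f → F (x ∷ᵥ f)))
  Σ-allFuns m xs F = trans (Σ-concatMap (λ x → map (x ∷ᵥ_) (allFuns m xs)) xs F)
    (Σ-cong xs (λ x → reflexive (Σ-map (x ∷ᵥ_) (allFuns m xs) F)))

  Σ-permute : ∀ {m} (π : Permutation.Permutation m m) f → ΣR (allFin m) (f ∘ Permutation._⟨$⟩ʳ_ π) ≈ ΣR (allFin m) f
  Σ-permute {m} π f = begin
    ΣR (allFin m) (f ∘ Permutation._⟨$⟩ʳ_ π)   ≡⟨ Σ-tabulate {m = m} id _ ⟩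
    sum (f ∘ Permutation._⟨$⟩ʳ_ π)             ≈⟨ sum-permute f π ⟨
    sum f                                      ≡⟨ Σ-tabulate {m = m} id f ⟨
    ΣR (allFin m) f                            ∎

  Σ-support : ∀ {m} z (f : Fin m → Carrier) → (∀ k → k ≢ z → f k ≈ 0#) → ΣR (allFin m) f ≈ f z
  Σ-support z f f≈0 = trans (reflexive (Σ-tabulate id f)) (sum-support z f f≈0)
    where
    sum-support : ∀ {m} z (f : Fin m → Carrier) → (∀ k → k ≢ z → f k ≈ 0#) → sum f ≈ f z
    sum-support zero    f p = trans (+-congˡ (sum-zero (f ∘ suc) (λ k → p (suc k) (λ ())))) (+-identityʳ _)
    sum-support (suc z) f p = trans (+-cong (p zero (λ ())) (sum-support z (f ∘ suc) (λ k k≢z → p (suc k) (k≢z ∘ suc-injective)))) (+-identityˡ _)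

  Σ-allFuns-support : ∀ {k} z m (F : (Fin m → Fin k) → Carrier) →
                      (∀ {f g} → (∀ i → f i ≡ g i) → F f ≈ F g) →
                      (∀ f i → f i ≢ z → F f ≈ 0#) → ΣR (allFuns m (allFin k)) F ≈ F (λ _ → z)
  Σ-allFuns-support     z zero    F F-cong F≈0 = trans (+-identityʳ _) (F-cong λ ())
  Σ-allFuns-support {k} z (suc m) F F-cong F≈0 = begin
    ΣR (allFuns (suc m) (allFin k)) F
      ≈⟨ Σ-allFuns m (allFin k) F ⟩
    ΣR (allFin k) (λ x → ΣR (allFuns m (allFin k)) (λ f → F (x ∷ᵥ f)))
      ≈⟨ Σ-cong (allFin k) (λ x → Σ-allFuns-support z m (λ f → F (x ∷ᵥ f))
           (λ p → F-cong λ { zero → ≡.refl ; (suc i) → p i }) (λ f i → F≈0 (x ∷ᵥ f) (suc i))) ⟩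
    ΣR (allFin k) (λ x → F (x ∷ᵥ (λ _ → z)))
      ≈⟨ Σ-support z _ (λ x x≢z → F≈0 (x ∷ᵥ (λ _ → z)) zero x≢z) ⟩
    F (z ∷ᵥ (λ _ → z))
      ≈⟨ F-cong (λ { zero → ≡.refl ; (suc i) → ≡.refl }) ⟩
    F (λ _ → z) ∎

  module _ {a b ℓ′} {A : Set a} {B : Set b} (_~_ : B → B → Set ℓ′) (~-refl : ∀ {x} → x ~ x)
           (N : Carrier) (xs : List A) (ys : List B) where
    -- If in each coordinate substituting `π i` multiplies sums by `N`, then over m coordinates the
    -- factor is the m-th power. It is used with `N` = 1 for translations and with `N` = n for
    -- forgetting the first entry of every row.
    Σ-allFuns-reindex : ∀ m (π : Fin m → A → B) →
      (∀ i f → (∀ {x y} → x ~ y → f x ≈ f y) → ΣR xs (f ∘ π i) ≈ N * ΣR ys f) →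
      ∀ F → (∀ {f g} → (∀ i → f i ~ g i) → F f ≈ F g) →
      ΣR (allFuns m xs) (λ f → F (λ i → π i (f i))) ≈ N ^ᴿ m * ΣR (allFuns m ys) F
    Σ-allFuns-reindex zero    π π-Σ F F-cong = trans (+-congʳ (F-cong λ ())) (sym (*-identityˡ _))
    Σ-allFuns-reindex (suc m) π π-Σ F F-cong = begin
      ΣR (allFuns (suc m) xs) (λ f → F (λ i → π i (f i)))
        ≈⟨ Σ-allFuns m xs (λ f → F (λ i → π i (f i))) ⟩
      ΣR xs (λ x → ΣR (allFuns m xs) (λ f → F (λ i → π i ((x ∷ᵥ f) i))))
        ≈⟨ Σ-cong xs (λ x → Σ-cong (allFuns m xs) (λ f → F-cong λ { zero → ~-refl ; (suc i) → ~-refl })) ⟩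
      ΣR xs (λ x → ΣR (allFuns m xs) (λ f → F (π zero x ∷ᵥ (λ i → π (suc i) (f i)))))
        ≈⟨ Σ-cong xs (λ x → Σ-allFuns-reindex m (π ∘ suc) (λ i → π-Σ (suc i)) (λ f → F (π zero x ∷ᵥ f))
             (λ p → F-cong λ { zero → ~-refl ; (suc i) → p i })) ⟩
      ΣR xs (λ x → N ^ᴿ m * G (π zero x))
        ≈⟨ Σ-distribˡ xs (N ^ᴿ m) (G ∘ π zero) ⟩
      N ^ᴿ m * ΣR xs (G ∘ π zero)
        ≈⟨ *-congˡ (π-Σ zero G (λ x~y → Σ-cong (allFuns m ys) (λ f → F-cong λ { zero → x~y ; (suc i) → ~-refl }))) ⟩
      N ^ᴿ m * (N * ΣR ys G)
        ≈⟨ trans (x∙yz≈y∙xz _ _ _) (sym (*-assoc _ _ _)) ⟩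
      N * N ^ᴿ m * ΣR ys G
        ≈⟨ *-congˡ (Σ-allFuns m ys F) ⟨
      N * N ^ᴿ m * ΣR (allFuns (suc m) ys) F ∎
      where
      G : B → Carrier
      G y = ΣR (allFuns m ys) (λ f → F (y ∷ᵥ f))

  ^ᴿ-cong : ∀ k {x y} → x ≈ y → x ^ᴿ k ≈ y ^ᴿ k
  ^ᴿ-cong zero    p = refl
  ^ᴿ-cong (suc k) p = *-cong p (^ᴿ-cong k p)

  ^ᴿ-+ : ∀ x j k → x ^ᴿ (j ℕ.+ k) ≈ x ^ᴿ j * x ^ᴿ k
  ^ᴿ-+ x zero    k = sym (*-identityˡ _)
  ^ᴿ-+ x (suc j) k = trans (*-congˡ (^ᴿ-+ x j k)) (sym (*-assoc _ _ _))

  1^ᴿ : ∀ k → 1# ^ᴿ k ≈ 1#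
  1^ᴿ zero    = refl
  1^ᴿ (suc k) = trans (*-identityˡ _) (1^ᴿ k)

  ^ᴿ-% : ∀ {x n} .{{_ : NonZero n}} → x ^ᴿ n ≈ 1# → ∀ k → x ^ᴿ (k ℕ.% n) ≈ x ^ᴿ k
  ^ᴿ-% {x} {n} x^n≈1 k = begin
    x ^ᴿ (k ℕ.% n)                               ≈⟨ *-identityʳ _ ⟨
    x ^ᴿ (k ℕ.% n) * 1#                          ≈⟨ *-congˡ (multiple (k ℕ./ n)) ⟨
    x ^ᴿ (k ℕ.% n) * x ^ᴿ (k ℕ./ n ℕ.* n)        ≈⟨ ^ᴿ-+ x (k ℕ.% n) _ ⟨
    x ^ᴿ (k ℕ.% n ℕ.+ k ℕ./ n ℕ.* n)             ≡⟨ ≡.cong (x ^ᴿ_) (ℕ.m≡m%n+[m/n]*n k n) ⟨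
    x ^ᴿ k                                       ∎
    where
    multiple : ∀ q → x ^ᴿ (q ℕ.* n) ≈ 1#
    multiple zero    = refl
    multiple (suc q) = trans (^ᴿ-+ x n (q ℕ.* n)) (trans (*-cong x^n≈1 (multiple q)) (*-identityˡ 1#))

-- The quotient is truncated, so it may be split only because the summand 2 (r + 1) is divisible by
-- 2.
triangular-suc : ∀ r → (suc r ℕ.* r) ℕ./ 2 ≡ r ℕ.+ (r ℕ.* (r ℕ.∸ 1)) ℕ./ 2
triangular-suc zero    = ≡.refl
triangular-suc (suc r) = begin
  (suc (suc r) ℕ.* suc r) ℕ./ 2              ≡⟨ ≡.cong (ℕ._/ 2) (ℕ.*-distribʳ-+ (suc r) 2 r) ⟩
  (2 ℕ.* suc r ℕ.+ r ℕ.* suc r) ℕ./ 2        ≡⟨ ℕ.+-distrib-/-∣ˡ {2 ℕ.* suc r} (r ℕ.* suc r) (ℕ.m∣m*n (suc r)) ⟩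
  (2 ℕ.* suc r) ℕ./ 2 ℕ.+ (r ℕ.* suc r) ℕ./ 2
    ≡⟨ ≡.cong₂ ℕ._+_ (≡.trans (≡.cong (ℕ._/ 2) (ℕ.*-comm 2 (suc r))) (ℕ.m*n/n≡m (suc r) 2)) (≡.cong (ℕ._/ 2) (ℕ.*-comm r (suc r))) ⟩
  suc r ℕ.+ (suc r ℕ.* r) ℕ./ 2              ∎
  where open ≡.≡-Reasoning

-- Translation of summation variables in ℤ/n.

module GaussSums {c ℓ} (R : CommutativeRing c ℓ) (n : ℕ) .{{_ : NonZero n}} where
  open CommutativeRing R hiding (zero)
  open InRing R
  open ListSums R
  open Zmod n using (Zn; [_]ᵢ; elems; oneₙ; _·ₙ_; isUnit; Mat; allMats; tr; isInvertible)
  module Z where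
    open Residues n public
    open CommutativeRing residueRing public using (+-assoc; +-comm; -‿inverseˡ; -‿inverseʳ; +-identityˡ)
  open Z using (_+ₙ_; -ₙ_)
  open Algebra.Properties.Ring ring using ([y-z]x≈yx-zx)
  open Algebra.Properties.Group +-group using (x∙y⁻¹≈ε⇒x≈y)
  open Algebra.Properties.CommutativeSemigroup *-commutativeSemigroup using (interchange; x∙yz≈y∙xz)
  open SetoidReasoning setoid

  Σ-shift : ∀ t f → ΣR elems (λ x → f (x +ₙ t)) ≈ ΣR elems f
  Σ-shift t = Σ-permute (Permutation.permutation (_+ₙ t) (_+ₙ (-ₙ t))
    (λ x → cancel x (-ₙ t) t (Z.-‿inverseˡ t)) (λ x → cancel x t (-ₙ t) (Z.-‿inverseʳ t)))
    where
    cancel : ∀ x s t → s +ₙ t ≡ Z.0# → (x +ₙ s) +ₙ t ≡ x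
    cancel x s t s+t≡0 = ≡.trans (Z.+-assoc x s t) (≡.trans (≡.cong (x +ₙ_) s+t≡0) (Z.+-identityʳ x))

  Σ-shift-vec : ∀ {m} (t : Vector Zn m) F → (∀ {u v} → (∀ j → u j ≡ v j) → F u ≈ F v) →
                ΣR (allFuns m elems) (λ v → F (λ j → v j +ₙ t j)) ≈ ΣR (allFuns m elems) F
  Σ-shift-vec {m} t F F-cong = trans
    (Σ-allFuns-reindex _≡_ ≡.refl 1# elems elems m (λ j x → x +ₙ t j)
      (λ j f _ → trans (Σ-shift (t j) f) (sym (*-identityˡ _))) F F-cong)
    (trans (*-congʳ (1^ᴿ m)) (*-identityˡ _))

  Σ-shift-rows : ∀ {r m} (T : Fin r → Vector Zn m) F → (∀ {X Y} → (∀ i j → X i j ≡ Y i j) → F X ≈ F Y) →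
                 ΣR (allFuns r (allFuns m elems)) (λ X → F (λ i j → X i j +ₙ T i j)) ≈ ΣR (allFuns r (allFuns m elems)) F
  Σ-shift-rows {r} {m} T F F-cong = trans
    (Σ-allFuns-reindex (λ u v → ∀ j → u j ≡ v j) (λ _ → ≡.refl) 1# (allFuns m elems) (allFuns m elems) r
      (λ i v j → v j +ₙ T i j) (λ i f f-cong → trans (Σ-shift-vec (T i) f f-cong) (sym (*-identityˡ _))) F F-cong)
    (trans (*-congʳ (1^ᴿ r)) (*-identityˡ _))

  -- Each of the r rows has n extensions by a first entry, on which the summand does not depend.
  Σ-tail-rows : ∀ {r m} F → (∀ {X Y} → (∀ i j → X i j ≡ Y i j) → F X ≈ F Y) →
                ΣR (allFuns r (allFuns (suc m) elems)) (λ X → F (λ i → tail (X i))) ≈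
                ℕ→R n ^ᴿ r * ΣR (allFuns r (allFuns m elems)) F
  Σ-tail-rows {r} {m} = Σ-allFuns-reindex (λ u v → ∀ j → u j ≡ v j) (λ _ → ≡.refl) (ℕ→R n)
    (allFuns (suc m) elems) (allFuns m elems) r (λ _ → tail) (λ _ f _ → begin
      ΣR (allFuns (suc m) elems) (f ∘ tail)                      ≈⟨ Σ-allFuns m elems (f ∘ tail) ⟩
      ΣR elems (λ x → ΣR (allFuns m elems) f)                    ≈⟨ Σ-const elems _ ⟩
      ℕ→R (length elems) * ΣR (allFuns m elems) f                ≡⟨ ≡.cong (λ k → ℕ→R k * ΣR (allFuns m elems) f) (length-tabulate (id {A = Zn})) ⟩
      ℕ→R n * ΣR (allFuns m elems) f                             ∎)

  -- The recursion for a multiplicative h on all residues and an additive character ψ.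

  module _ (h ψ : Zn → Carrier)
           (h-1 : h oneₙ ≈ 1#) (h-* : ∀ x y → h (x ·ₙ y) ≈ h x * h y)
           (ψ-0 : ψ Z.0# ≈ 1#) (ψ-+ : ∀ x y → ψ (x +ₙ y) ≈ ψ x * ψ y)
           -- Faithfulness is taken in the cancelling form in which the vanishing argument uses it.
           (ψ-faithful : ∀ {x} → x ≢ Z.0# → ∀ {s} → s ≈ ψ x * s → s ≈ 0#) where

    trace : ∀ {r} → Mat r → Zn
    trace X = Z.sum (λ i → X i i)

    weight : ∀ {r} → Mat r → Carrier
    weight X = h (Z.det X) * ψ (trace X)

    weight-cong : ∀ {r} {X Y : Mat r} → (∀ i j → X i j ≡ Y i j) → weight X ≈ weight Y
    weight-cong p = *-cong (reflexive (≡.cong h (Z.det-cong p))) (reflexive (≡.cong ψ (Z.sum-cong-≋ (λ i → p i i))))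

    gauss : ℕ → Carrier
    gauss r = ΣR (allMats r) weight

    gauss₁ : Carrier
    gauss₁ = ΣR elems (λ x → h x * ψ x)

    head-sum : ∀ r → Vector Zn (suc r) → Carrier
    head-sum r u = ΣR (allFuns r (allFuns (suc r) elems)) (λ X → weight (u ∷ᵥ X))

    head-sum-cong : ∀ {r u v} → (∀ j → u j ≡ v j) → head-sum r u ≈ head-sum r v
    head-sum-cong {r} {u} {v} p = Σ-cong (allFuns r (allFuns (suc r) elems)) (λ X → weight-cong {X = u ∷ᵥ X} {v ∷ᵥ X} λ { zero → p ; (suc i) j → ≡.refl })

    head-sum-vanishes : ∀ {r} u j → u (suc j) ≢ Z.0# → head-sum r u ≈ 0#
    head-sum-vanishes {r} u j uⱼ≢0 = ψ-faithful uⱼ≢0 (begin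
      head-sum r u
        -- Row `j` of `X` is row `suc j` of the full matrix, so its diagonal entry gains
        -- `u (suc j)`; the factor `Z.δ i j` leaves the other rows fixed.
        ≈⟨ Σ-shift-rows (λ i k → Z.δ i j ·ₙ u k) (λ X → weight (u ∷ᵥ X))
             (λ {X} {Y} p → weight-cong {X = u ∷ᵥ X} {u ∷ᵥ Y} λ { zero _ → ≡.refl ; (suc i) k → p i k }) ⟨
      ΣR (allFuns r (allFuns (suc r) elems)) (λ X → weight (u ∷ᵥ shifted X))
        ≈⟨ Σ-cong (allFuns r (allFuns (suc r) elems)) shift-weight ⟩
      ΣR (allFuns r (allFuns (suc r) elems)) (λ X → ψ (u (suc j)) * weight (u ∷ᵥ X))
        ≈⟨ Σ-distribˡ (allFuns r (allFuns (suc r) elems)) (ψ (u (suc j))) (λ X → weight (u ∷ᵥ X)) ⟩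
      ψ (u (suc j)) * head-sum r u ∎)
      where
      shifted : (Fin r → Vector Zn (suc r)) → Fin r → Vector Zn (suc r)
      shifted X i k = X i k +ₙ (Z.δ i j ·ₙ u k)
      shift-trace : ∀ X → trace (u ∷ᵥ shifted X) ≡ u (suc j) +ₙ trace (u ∷ᵥ X)
      shift-trace X = ≡.trans (≡.cong (u zero +ₙ_) (Z.sum-add-δ (λ i → X i (suc i)) (tail u) j))
        (≡.trans (≡.sym (Z.+-assoc (u zero) _ _)) (Z.+-comm _ (u (suc j))))
      shift-weight : ∀ X → weight (u ∷ᵥ shifted X) ≈ ψ (u (suc j)) * weight (u ∷ᵥ X)
      shift-weight X = begin
        h (Z.det (u ∷ᵥ shifted X)) * ψ (trace (u ∷ᵥ shifted X))
          ≡⟨ ≡.cong₂ (λ d t → h d * ψ t) (Z.add-head Z.det-multiAlternating u (λ i → Z.δ i j) X) (shift-trace X) ⟩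
        h (Z.det (u ∷ᵥ X)) * ψ (u (suc j) +ₙ trace (u ∷ᵥ X))
          ≈⟨ trans (*-congˡ (ψ-+ _ _)) (x∙yz≈y∙xz _ _ _) ⟩
        ψ (u (suc j)) * weight (u ∷ᵥ X) ∎

    -- Neither `x` nor the determinant of the block need be a unit here, which is why `h` has to be
    -- multiplicative on all residues.
    head-sum-corner : ∀ {r} x → head-sum r (x ∷ᵥ (λ _ → Z.0#)) ≈ h x * ψ x * (ℕ→R n ^ᴿ r * gauss r)
    head-sum-corner {r} x = begin
      head-sum r (x ∷ᵥ (λ _ → Z.0#))
        ≈⟨ Σ-cong (allFuns r (allFuns (suc r) elems)) (λ X → begin
             h (Z.det ((x ∷ᵥ (λ _ → Z.0#)) ∷ᵥ X)) * ψ (x +ₙ trace (λ i → tail (X i)))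
               ≡⟨ ≡.cong (λ d → h d * ψ (x +ₙ trace (λ i → tail (X i)))) (Z.det-corner ((x ∷ᵥ (λ _ → Z.0#)) ∷ᵥ X) (λ _ → ≡.refl)) ⟩
             h (x ·ₙ Z.det (λ i → tail (X i))) * ψ (x +ₙ trace (λ i → tail (X i)))
               ≈⟨ *-cong (h-* _ _) (ψ-+ _ _) ⟩
             (h x * h (Z.det (λ i → tail (X i)))) * (ψ x * ψ (trace (λ i → tail (X i))))
               ≈⟨ interchange _ _ _ _ ⟩
             h x * ψ x * weight (λ i → tail (X i)) ∎) ⟩
      ΣR (allFuns r (allFuns (suc r) elems)) (λ X → h x * ψ x * weight (λ i → tail (X i)))
        ≈⟨ Σ-distribˡ (allFuns r (allFuns (suc r) elems)) (h x * ψ x) (λ X → weight (λ i → tail (X i))) ⟩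
      h x * ψ x * ΣR (allFuns r (allFuns (suc r) elems)) (λ X → weight (λ i → tail (X i)))
        ≈⟨ *-congˡ (Σ-tail-rows {r} weight weight-cong) ⟩
      h x * ψ x * (ℕ→R n ^ᴿ r * gauss r) ∎

    gauss-suc : ∀ r → gauss (suc r) ≈ gauss₁ * (ℕ→R n ^ᴿ r * gauss r)
    gauss-suc r = begin
      gauss (suc r)
        ≈⟨ Σ-allFuns r (allFuns (suc r) elems) weight ⟩
      ΣR (allFuns (suc r) elems) (head-sum r)
        ≈⟨ Σ-allFuns r elems (head-sum r) ⟩
      ΣR elems (λ x → ΣR (allFuns r elems) (λ v → head-sum r (x ∷ᵥ v)))
        ≈⟨ Σ-cong elems (λ x → Σ-allFuns-support Z.0# r (λ v → head-sum r (x ∷ᵥ v))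
             (λ {v} {w} p → head-sum-cong {u = x ∷ᵥ v} {x ∷ᵥ w} λ { zero → ≡.refl ; (suc j) → p j }) (λ v j → head-sum-vanishes (x ∷ᵥ v) j)) ⟩
      ΣR elems (λ x → head-sum r (x ∷ᵥ (λ _ → Z.0#)))
        ≈⟨ Σ-cong elems (head-sum-corner {r}) ⟩
      ΣR elems (λ x → h x * ψ x * (ℕ→R n ^ᴿ r * gauss r))
        ≈⟨ Σ-distribʳ elems (ℕ→R n ^ᴿ r * gauss r) (λ x → h x * ψ x) ⟩
      gauss₁ * (ℕ→R n ^ᴿ r * gauss r) ∎

    gauss-formula : ∀ r → gauss r ≈ gauss₁ ^ᴿ r * ℕ→R n ^ᴿ ((r ℕ.* (r ℕ.∸ 1)) ℕ./ 2)
    gauss-formula zero    = begin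
      -- The only matrix of size 0 has determinant 1 and trace 0.
      h oneₙ * ψ Z.0# + 0#   ≈⟨ +-identityʳ _ ⟩
      h oneₙ * ψ Z.0#        ≈⟨ *-cong h-1 ψ-0 ⟩
      1# * 1#                ∎
    gauss-formula (suc r) = begin
      gauss (suc r)
        ≈⟨ gauss-suc r ⟩
      gauss₁ * (ℕ→R n ^ᴿ r * gauss r)
        ≈⟨ *-congˡ (trans (*-congˡ (gauss-formula r)) (x∙yz≈y∙xz _ _ _)) ⟩
      gauss₁ * (gauss₁ ^ᴿ r * (ℕ→R n ^ᴿ r * ℕ→R n ^ᴿ ((r ℕ.* (r ℕ.∸ 1)) ℕ./ 2)))
        ≈⟨ *-assoc _ _ _ ⟨
      gauss₁ ^ᴿ suc r * (ℕ→R n ^ᴿ r * ℕ→R n ^ᴿ ((r ℕ.* (r ℕ.∸ 1)) ℕ./ 2))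
        ≈⟨ *-congˡ (^ᴿ-+ (ℕ→R n) r _) ⟨
      gauss₁ ^ᴿ suc r * ℕ→R n ^ᴿ (r ℕ.+ (r ℕ.* (r ℕ.∸ 1)) ℕ./ 2)
        ≡⟨ ≡.cong (λ k → gauss₁ ^ᴿ suc r * ℕ→R n ^ᴿ k) (triangular-suc r) ⟨
      gauss₁ ^ᴿ suc r * ℕ→R n ^ᴿ ((suc r ℕ.* r) ℕ./ 2) ∎

  -- The given characters and their Gauss sums.

  extend : (Zn → Carrier) → Zn → Carrier
  extend χ x = if isUnit x then χ x else 0#

  module _ {χ : Zn → Carrier} (χ-mult : IsMultChar n χ) where
    extend-1 : extend χ oneₙ ≈ 1#
    extend-1 = go (isUnit oneₙ) (Z.unit⁺ {oneₙ} {oneₙ} (Z.·ₙ-identityˡ oneₙ))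
      where
      go : ∀ b → T b → (if b then χ oneₙ else 0#) ≈ 1#
      go true _ = proj₁ χ-mult

    -- A product is a unit exactly when both factors are, so the zeros of the two sides agree;
    -- elsewhere `χ` is multiplicative.
    extend-* : ∀ x y → extend χ (x ·ₙ y) ≈ extend χ x * extend χ y
    extend-* x y = go (isUnit (x ·ₙ y)) (isUnit x) (isUnit y) (Z.unit-*⁻ x y) (Z.unit-*⁺ x y) (proj₂ χ-mult x y)
      where
      go : ∀ a b c {u v w} → (T a → T b × T c) → (T b → T c → T a) → (T b → T c → u ≈ v * w) →
           (if a then u else 0#) ≈ (if b then v else 0#) * (if c then w else 0#)
      go true  true  true  _ _ p = p _ _
      go true  false _     q _ _ with () ← proj₁ (q _)
      go true  true  false q _ _ with () ← proj₂ (q _)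
      go false true  true  _ q _ with () ← q _ _
      go false false _     _ _ _ = sym (zeroˡ _)
      go false true  false _ _ _ = sym (zeroʳ _)

  if-* : ∀ b {u v} → (if b then u * v else 0#) ≈ (if b then u else 0#) * v
  if-* true  = refl
  if-* false = sym (zeroˡ _)

  gaussZ≈ : ∀ χ ψ → gaussZ n χ ψ ≈ ΣR elems (λ x → extend χ x * ψ x)
  gaussZ≈ χ ψ = trans (Σ-filter isUnit elems _) (Σ-cong elems (λ x → if-* (isUnit x)))

  gaussGL≈ : ∀ r χ ψ → gaussGL n r χ ψ ≈ ΣR (allMats r) (λ X → extend χ (Z.det X) * ψ (Z.sum (λ i → X i i)))
  gaussGL≈ r χ ψ = trans (Σ-filter isInvertible (allMats r) _) (Σ-cong (allMats r) (λ X → begin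
    (if isInvertible X then χ (Zmod.det n X) * ψ (tr X) else 0#)
      ≡⟨ ≡.cong (λ b → if b then χ (Zmod.det n X) * ψ (tr X) else 0#) (Z.isInvertible≡isUnit-det X) ⟩
    (if isUnit (Zmod.det n X) then χ (Zmod.det n X) * ψ (tr X) else 0#)
      ≡⟨ ≡.cong₂ (λ d t → if isUnit d then χ d * ψ t else 0#) (Z.det≡ X) (Z.tr≡ X) ⟩
    (if isUnit (Z.det X) then χ (Z.det X) * ψ (Z.sum (λ i → X i i)) else 0#)
      ≈⟨ if-* (isUnit (Z.det X)) ⟩
    extend χ (Z.det X) * ψ (Z.sum (λ i → X i i)) ∎))

  module _ {ζ : Carrier} {a : ℤ} where
    addChar-power : ∀ x → addChar n ζ a x ≡ ζ ^ᴿ toℕ ([ a ]ᵢ ·ₙ x)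
    addChar-power x = ≡.cong (ζ ^ᴿ_) (Z.[]ᵢ-·ₙ a x)

    addChar-0 : addChar n ζ a Z.0# ≈ 1#
    addChar-0 = begin
      addChar n ζ a Z.0#              ≡⟨ addChar-power Z.0# ⟩
      ζ ^ᴿ toℕ ([ a ]ᵢ ·ₙ Z.0#)       ≡⟨ ≡.cong (λ x → ζ ^ᴿ toℕ x) (Z.zeroʳ [ a ]ᵢ) ⟩
      ζ ^ᴿ toℕ Z.0#                   ≡⟨ ≡.cong (ζ ^ᴿ_) Z.toℕ-0# ⟩
      1#                              ∎

    addChar-+ : ζ ^ᴿ n ≈ 1# → ∀ x y → addChar n ζ a (x +ₙ y) ≈ addChar n ζ a x * addChar n ζ a y
    addChar-+ ζⁿ≈1 x y = begin
      addChar n ζ a (x +ₙ y)                                  ≡⟨ addChar-power (x +ₙ y) ⟩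
      ζ ^ᴿ toℕ ([ a ]ᵢ ·ₙ (x +ₙ y))                           ≡⟨ ≡.cong (λ z → ζ ^ᴿ toℕ z) (Z.·ₙ-distribˡ-+ₙ [ a ]ᵢ x y) ⟩
      ζ ^ᴿ toℕ (([ a ]ᵢ ·ₙ x) +ₙ ([ a ]ᵢ ·ₙ y))               ≡⟨ ≡.cong (ζ ^ᴿ_) (Z.toℕ-[] _) ⟩
      ζ ^ᴿ ((toℕ ([ a ]ᵢ ·ₙ x) ℕ.+ toℕ ([ a ]ᵢ ·ₙ y)) ℕ.% n)  ≈⟨ ^ᴿ-% ζⁿ≈1 _ ⟩
      ζ ^ᴿ (toℕ ([ a ]ᵢ ·ₙ x) ℕ.+ toℕ ([ a ]ᵢ ·ₙ y))          ≈⟨ ^ᴿ-+ ζ (toℕ ([ a ]ᵢ ·ₙ x)) _ ⟩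
      ζ ^ᴿ toℕ ([ a ]ᵢ ·ₙ x) * ζ ^ᴿ toℕ ([ a ]ᵢ ·ₙ y)         ≡⟨ ≡.cong₂ _*_ (addChar-power x) (addChar-power y) ⟨
      addChar n ζ a x * addChar n ζ a y                       ∎

    -- With k the residue of a x, the hypothesis on s says that (ζ^k - 1) s = 0. Coprimality of a
    -- and n gives 0 < k < n, so primitivity excludes ζ^k = 1, and the domain property leaves s = 0.
    addChar-faithful : IsIntegralDomain → IsPrimitiveRoot n ζ → gcd ∣ a ∣ n ≡ 1 →
                       ∀ {x} → x ≢ Z.0# → ∀ {s} → s ≈ addChar n ζ a x * s → s ≈ 0#
    addChar-faithful (_ , no-zero-divisors) (_ , ζᵏ≉1) a⊥n {x} x≢0 {s} s≈ψs
      with no-zero-divisors (ζ ^ᴿ k - 1#) s annihilates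
      where
      k : ℕ
      k = toℕ ([ a ]ᵢ ·ₙ x)
      annihilates : (ζ ^ᴿ k - 1#) * s ≈ 0#
      annihilates = begin
        (ζ ^ᴿ k - 1#) * s          ≈⟨ [y-z]x≈yx-zx s _ 1# ⟩
        ζ ^ᴿ k * s - 1# * s        ≈⟨ +-congˡ (-‿cong (*-identityˡ s)) ⟩
        ζ ^ᴿ k * s - s             ≈⟨ +-congʳ (trans (*-congʳ (reflexive (≡.sym (addChar-power x)))) (sym s≈ψs)) ⟩
        s - s                      ≈⟨ -‿inverseʳ s ⟩
        0#                         ∎
    ... | inj₂ s≈0 = s≈0
    ... | inj₁ ζᵏ-1≈0 = contradiction (x∙y⁻¹≈ε⇒x≈y _ _ ζᵏ-1≈0)
      (ζᵏ≉1 _ (ℕ.n≢0⇒n>0 (x≢0 ∘ Z.[]ᵢ-·ₙ-cancel a a⊥n x)) (toℕ<n ([ a ]ᵢ ·ₙ x)))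

theorem1 : ∀ {c ℓ} (R : CommutativeRing c ℓ) → InRing.IsIntegralDomain R →
    (n : ℕ) .{{_ : NonZero n}} → (r : ℕ) → 1 ≤ r →
    (ζ : CommutativeRing.Carrier R) → InRing.IsPrimitiveRoot R n ζ →
    (χ : Zmod.Zn n → CommutativeRing.Carrier R) → InRing.IsMultChar R n χ →
    (a : ℤ) → gcd ∣ a ∣ n ≡ 1 →
    CommutativeRing._≈_ R
    (InRing.gaussGL R n r χ (InRing.addChar R n ζ a))
    (CommutativeRing._*_ R
    (InRing._^ᴿ_ R (InRing.gaussZ R n χ (InRing.addChar R n ζ a)) r)
    (InRing._^ᴿ_ R (InRing.ℕ→R R n) ((r *ℕ (r ∸ 1)) / 2)))
theorem1 R domain n r _ ζ ζ-root χ χ-mult a a⊥n = begin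
  gaussGL n r χ ψ
    ≈⟨ gaussGL≈ r χ ψ ⟩
  gauss (extend χ) ψ extend-χ-1 extend-χ-* ψ-0 ψ-+ ψ-faithful r
    ≈⟨ gauss-formula (extend χ) ψ extend-χ-1 extend-χ-* ψ-0 ψ-+ ψ-faithful r ⟩
  gauss₁ (extend χ) ψ extend-χ-1 extend-χ-* ψ-0 ψ-+ ψ-faithful ^ᴿ r * ℕ→R n ^ᴿ ((r ℕ.* (r ℕ.∸ 1)) ℕ./ 2)
    ≈⟨ *-congʳ (^ᴿ-cong r (gaussZ≈ χ ψ)) ⟨
  gaussZ n χ ψ ^ᴿ r * ℕ→R n ^ᴿ ((r ℕ.* (r ℕ.∸ 1)) ℕ./ 2) ∎
  where
  open CommutativeRing R hiding (zero)
  open InRing R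
  open ListSums R using (^ᴿ-cong)
  open GaussSums R n
  open SetoidReasoning setoid
  ψ = addChar n ζ a
  extend-χ-1 = extend-1 χ-mult
  extend-χ-* = extend-* χ-mult
  ψ-0 = addChar-0 {ζ} {a}
  ψ-+ = addChar-+ {ζ} {a} (proj₁ ζ-root)
  ψ-faithful : ∀ {x} → x ≢ Residues.0# n → ∀ {s} → s ≈ ψ x * s → s ≈ 0#
  ψ-faithful = addChar-faithful {ζ} {a} domain ζ-root a⊥n
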